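{- Let $n\ge 2$. The Voronoi cell $V(\mathbf 0)$ of the lattice $A_n$ is the disjoint union of $n+1$ congruent hyper-rhombi, and each of these hyper-rhombi is in turn composed of $n!$ congruent simplices. Specifically, the union of the $n!$ images of $\sigma_0$ under the permutations of the first $n$ components forms the $n$-dimensional hyper-rhombus $\Diamond_{n+1}$: $$\Diamond_{n+1}=\bigsqcup_{Q\in G_1}Q\sigma_0,\qquad G_1:=\left\{\begin{bmatrix}\Pi&0\\0&1\end{bmatrix}:\Pi\in S_n\right\},$$ and the union of the $n+1$ images of $\Diamond_{n+1}$ under the circular shifts in $C_{n+1}$ forms $V(\mathbf 0)$: $$V(\mathbf 0)=\bigsqcup_{\Gamma\in C_{n+1}}\Gamma\,\Diamond_{n+1}=\bigsqcup_{j=1}^{n+1}\Diamond_j,\qquad\text{where } \Diamond_j=\Gamma_{n+1,\,j\bmod (n+1)}\,\Diamond_{n+1}.$$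
   Context: Let $\mathbf 1=(1,\dots,1)^T\in\mathbb R^{n+1}$, $H=\{x\in\mathbb R^{n+1}:x\cdot\mathbf 1=0\}$, and let $e_i$ be the standard unit vectors. The lattice $A_n$ is $\mathbb Z^{n+1}\cap H$. Its Voronoi cell at the origin, taken inside $H$, is $V(\mathbf 0)=\{x\in H:\|x\|\le\|x-q\|\text{ for all }q\in A_n\}$. Let $\xi_i=e_i-\frac1{n+1}\mathbf 1$ for $1\le i\le n+1$ (the orthogonal projection of $e_i$ onto $H$). For $1\le j\le n+1$ put $\Diamond_j=\{\sum_{i\ne j}t_i\xi_i:0\le t_i\le1\}$, the $n$-dimensional parallelepiped spanned by all $\xi_i$ with $i\neq j$. Let $v_j=\sum_{i=1}^j\xi_i$ for $0\le j\le n$ (so $v_0=\mathbf 0$), and let $\sigma_0$ be the convex hull of $\{v_0,\dots,v_n\}$, an $n$-simplex in $H$. $S_n$ denotes the group of $n\times n$ permutation matrices. For $0\le j\le m-1$, $\Gamma_{m,j}$ is the $m\times m$ circular shift matrix obtained by circularly shifting the rows of the identity matrix downward by $j$, i.e. $\Gamma_{m,j}e_i=e_{i+j}$ with indices taken modulo $m$ in $\{1,\dots,m\}$; $C_m=\{\Gamma_{m,j}:0\le j\le m-1\}$. An $m$-dimensional hyper-rhombus is defined recursively: for $m=2$ it is a rhombus; for $m\ge3$ it is a parallelepiped all of whose $(m-1)$-dimensional faces are congruent $(m-1)$-dimensional hyper-rhombi. Congruent means related by an isometry. "Disjoint union" $\bigsqcup$ (and "composed of") for closed polytopes of the same dimension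 means that the union is as stated and the pieces have pairwise disjoint relative interiors. -}

module Defs where

open import Level using (Level; 0ℓ; _⊔_) renaming (suc to lsuc)
open import Algebra.Bundles using (CommutativeRing)
import Algebra.Definitions.RawMonoid as RawMonoidDefs
import Algebra.Properties.Ring as RingProperties
open import Data.Nat.Base as ℕ using (ℕ; zero; suc)
open import Data.Nat.DivMod using (_mod_)
open import Data.Integer.Base using (ℤ; +_; -[1+_])
open import Data.Fin.Base using (Fin; zero; suc; toℕ; fromℕ; Fin′; inject)
open import Data.Fin.Properties using (_≟_)
open import Data.Fin.Permutation using (Permutation′; _⟨$⟩ʳ_)
open import Data.Fin.Relation.Unary.Top using (view; ‵fromℕ; ‵inject₁)
open import Data.Vec.Functional using (Vector; removeAt)
import Data.Vec.Functional.Relation.Binary.Equality.Setoid as VectorEquality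
open import Data.Product using (Σ; ∃; _×_; _,_; proj₁; proj₂)
open import Data.Sum.Base using (_⊎_; inj₁; inj₂)
open import Data.Bool.Base using (if_then_else_)
open import Function.Bundles using (Inverse)
open import Relation.Nullary using (¬_; does)
open import Relation.Unary using (Pred; _∈_; _∩_; _≐_; ⋃; Satisfiable; _⊥_)
open import Relation.Binary.Core using (Rel)
open import Relation.Binary.Bundles using (Setoid)
open import Relation.Binary.Structures using (IsDecTotalOrder)
import Relation.Binary.Construct.NonStrictToStrict as NonStrictToStrict
import Relation.Binary.Construct.On as On
import Relation.Binary.PropositionalEquality as ≡

-- The standard library has no real numbers.  ℝ is specified by the usual
-- (classical) axioms: a totally ordered field in which every nonempty set that
-- is bounded above has a least upper bound.  These axioms determine ℝ up to
-- isomorphism.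

record CompleteOrderedField : Set₁ where
  infix 4 _≤_
  field
    commutativeRing : CommutativeRing 0ℓ 0ℓ
  open CommutativeRing commutativeRing public

  field
    _≤_             : Rel Carrier 0ℓ
    isDecTotalOrder : IsDecTotalOrder _≈_ _≤_

    0≉1       : ¬ 0# ≈ 1#
    -- The value of 0# ⁻¹ is unspecified.
    _⁻¹       : Carrier → Carrier
    ⁻¹-inverse : ∀ x → ¬ x ≈ 0# → x * x ⁻¹ ≈ 1#

    +-monoˡ-≤ : ∀ z {x y} → x ≤ y → x + z ≤ y + z
    *-nonNeg  : ∀ {x y} → 0# ≤ x → 0# ≤ y → 0# ≤ x * y

  UpperBound : Pred Carrier 0ℓ → Pred Carrier 0ℓ
  UpperBound S b = ∀ x → x ∈ S → x ≤ b

  field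
    supremum : (S : Pred Carrier 0ℓ) → Satisfiable S → Satisfiable (UpperBound S) →
               ∃ λ s → UpperBound S s × (∀ b → UpperBound S b → s ≤ b)

  open NonStrictToStrict _≈_ _≤_ public using (_<_)
  open RawMonoidDefs +-rawMonoid public using (sum) renaming (_×_ to _·ℕ_)

  module ≤ = IsDecTotalOrder isDecTotalOrder

  fromℤ : ℤ → Carrier
  fromℤ (+ n)    = n ·ℕ 1#
  fromℤ -[1+ n ] = - (suc n ·ℕ 1#)

  BelowSqrt : Carrier → Pred Carrier 0ℓ
  BelowSqrt a y = y ≤ 0# ⊎ y * y ≤ a

  private
    0≤y-x : ∀ {x y} → x ≤ y → 0# ≤ y + - x
    0≤y-x {x} x≤y = ≤.≤-respˡ-≈ (-‿inverseʳ x) (+-monoˡ-≤ (- x) x≤y)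

    0≤1 : 0# ≤ 1#
    0≤1 with ≤.total 0# 1#
    ... | inj₁ p = p
    ... | inj₂ q = ≤.≤-respʳ-≈ eq (*-nonNeg 0≤-1 0≤-1)
      where
      open RingProperties ring
      0≤-1 : 0# ≤ - 1#
      0≤-1 = ≤.≤-respʳ-≈ (+-identityˡ (- 1#)) (0≤y-x q)
      eq : - 1# * - 1# ≈ 1#
      eq = trans (-1*x≈-x (- 1#)) (-‿involutive 1#)

    1≤y⇒y≤y² : ∀ {y} → 1# ≤ y → y ≤ y * y
    1≤y⇒y≤y² {y} 1≤y = ≤.≤-respˡ-≈ (+-identityˡ y) (≤.≤-respʳ-≈ eq (+-monoˡ-≤ y h))
      where
      open RingProperties ring
      h : 0# ≤ y * (y + - 1#)
      h = *-nonNeg (≤.trans 0≤1 1≤y) (0≤y-x 1≤y)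
      eq : y * (y + - 1#) + y ≈ y * y
      eq = trans (+-cong (distribˡ y y (- 1#)) refl)
           (trans (+-assoc (y * y) (y * - 1#) y)
           (trans (+-cong refl (trans (+-cong (trans (*-comm y (- 1#)) (-1*x≈-x y)) refl)
                                      (-‿inverseˡ y)))
                  (+-identityʳ (y * y))))

    bound : ∀ a b → 1# ≤ b → a ≤ b → UpperBound (BelowSqrt a) b
    bound a b 1≤b a≤b y (inj₁ y≤0) = ≤.trans y≤0 (≤.trans 0≤1 1≤b)
    bound a b 1≤b a≤b y (inj₂ y²≤a) with ≤.total y 1#
    ... | inj₁ y≤1 = ≤.trans y≤1 1≤b
    ... | inj₂ 1≤y = ≤.trans (1≤y⇒y≤y² 1≤y) (≤.trans y²≤a a≤b)

  BelowSqrt-bounded : ∀ a → Satisfiable (UpperBound (BelowSqrt a))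
  BelowSqrt-bounded a with ≤.total 1# a
  ... | inj₁ 1≤a = a  , bound a a 1≤a ≤.refl
  ... | inj₂ a≤1 = 1# , bound a 1# ≤.refl a≤1

  -- The nonnegative square root of a if 0 ≤ a, and 0 otherwise.
  √_ : Carrier → Carrier
  √ a = proj₁ (supremum (BelowSqrt a) (0# , inj₁ ≤.refl) (BelowSqrt-bounded a))

module Geometry (ℝ : CompleteOrderedField) where

  open CompleteOrderedField ℝ
    using (_≈_; _≤_; _<_; 0#; 1#; _+_; _-_; _*_; _⁻¹; sum; _·ℕ_; fromℤ; √_; setoid)
    renaming (Carrier to R)
  open VectorEquality setoid using (_≋_; ≋-setoid) public

  private
    variable
      N m n d k : ℕ

  --------------------------------------------------------------------------
  -- Euclidean space and its point sets

  Point : ℕ → Set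
  Point N = Vector R N

  PointSet : ℕ → Set₁
  PointSet N = Pred (Point N) 0ℓ

  infixl 6 _+ᵥ_ _-ᵥ_
  infix  7 _∙_

  _+ᵥ_ _-ᵥ_ : Point N → Point N → Point N
  (x +ᵥ y) i = x i + y i
  (x -ᵥ y) i = x i - y i

  0ᵥ 𝟏 : Point N
  0ᵥ _ = 0#
  𝟏  _ = 1#

  _∙_ : Point N → Point N → R
  x ∙ y = sum (λ i → x i * y i)

  ‖_‖ : Point N → R
  ‖ x ‖ = √ (x ∙ x)

  δ : Fin n → Fin n → R
  δ i j = if does (i ≟ j) then 1# else 0#

  e : Fin N → Point N
  e i = δ i

  combination : Vector R k → Vector (Point N) k → Point N
  combination c p l = sum (λ i → c i * p i l)

  image : (Point N → Point N) → PointSet N → PointSet N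
  image f P y = ∃ λ x → x ∈ P × y ≋ f x

  IsIsometry : (Point N → Point N) → Set
  IsIsometry f = ∀ x y → ‖ f x -ᵥ f y ‖ ≈ ‖ x -ᵥ y ‖

  infix 4 _≅_
  _≅_ : PointSet N → PointSet N → Set
  P ≅ Q = ∃ λ f → IsIsometry f × image f P ≐ Q

  LinearlyIndependent : Vector (Point N) k → Set
  LinearlyIndependent a = ∀ c → combination c a ≋ 0ᵥ → ∀ i → c i ≈ 0#

  AffinelyIndependent : Vector (Point N) k → Set
  AffinelyIndependent p =
    ∀ c → sum c ≈ 0# → combination c p ≋ 0ᵥ → ∀ i → c i ≈ 0#

  affineHull : PointSet N → PointSet N
  affineHull {N} P x = ∃ λ k → Σ (Vector (Point N) k) λ p → Σ (Vector R k) λ c →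
    (∀ i → p i ∈ P) × sum c ≈ 1# × x ≋ combination c p

  relativeInterior : PointSet N → PointSet N
  relativeInterior P x = x ∈ P ×
    ∃ λ ε → 0# < ε × (∀ y → y ∈ affineHull P → ‖ y -ᵥ x ‖ < ε → y ∈ P)

  convexHull : Vector (Point N) k → PointSet N
  convexHull p x =
    ∃ λ c → (∀ i → 0# ≤ c i) × sum c ≈ 1# × x ≋ combination c p

  parallelepiped : Point N → Vector (Point N) k → PointSet N
  parallelepiped p a x =
    ∃ λ t → (∀ i → 0# ≤ t i × t i ≤ 1#) × x ≋ p +ᵥ combination t a

  --------------------------------------------------------------------------
  -- Polytopes

  IsSimplex : ℕ → PointSet N → Set
  IsSimplex {N} d P = Σ (Vector (Point N) (suc d)) λ p →
    AffinelyIndependent p × P ≐ convexHull p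

  IsParallelepiped : ℕ → PointSet N → Set
  IsParallelepiped {N} d P = Σ (Point N) λ p → Σ (Vector (Point N) d) λ a →
    LinearlyIndependent a × P ≐ parallelepiped p a

  IsRhombus : PointSet N → Set
  IsRhombus {N} P = Σ (Point N) λ p → Σ (Vector (Point N) 2) λ a →
    LinearlyIndependent a × P ≐ parallelepiped p a × ‖ a zero ‖ ≈ ‖ a (suc zero) ‖

  HasDimension : ℕ → PointSet N → Set
  HasDimension {N} d P =
    (Σ (Vector (Point N) (suc d)) λ p → (∀ i → p i ∈ P) × AffinelyIndependent p) ×
    (∀ (p : Vector (Point N) (suc (suc d))) → (∀ i → p i ∈ P) → ¬ AffinelyIndependent p)

  -- F is the intersection of P with a supporting hyperplane.  (Also allowing
  -- u = 0 admits P and ∅ as faces; the dimension excludes them below.)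
  IsFace : PointSet N → PointSet N → Set
  IsFace F P = ∃ λ u → ∃ λ c →
    (∀ x → x ∈ P → u ∙ x ≤ c) × F ≐ (P ∩ λ x → u ∙ x ≈ c)

  IsFaceOfDim : ℕ → PointSet N → PointSet N → Set
  IsFaceOfDim d F P = IsFace F P × HasDimension d F

  data IsHyperRhombus {N : ℕ} : ℕ → PointSet N → Set₁ where
    rhombus : ∀ {P} → IsRhombus P → IsHyperRhombus 2 P
    higher  : ∀ {m P} → IsParallelepiped (3 ℕ.+ m) P →
              (∀ F → IsFaceOfDim (2 ℕ.+ m) F P → IsHyperRhombus (2 ℕ.+ m) F) →
              (∀ F G → IsFaceOfDim (2 ℕ.+ m) F P → IsFaceOfDim (2 ℕ.+ m) G P → F ≅ G) →
              IsHyperRhombus (3 ℕ.+ m) P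

  --------------------------------------------------------------------------
  -- Dissections

  -- P is the union of the pieces, and pieces at distinct indices have disjoint
  -- relative interiors.
  IsDisjointUnion : PointSet N → (I : Setoid 0ℓ 0ℓ) → (Setoid.Carrier I → PointSet N) → Set
  IsDisjointUnion P I piece =
    P ≐ ⋃ I.Carrier piece ×
    (∀ i j → ¬ i I.≈ j → relativeInterior (piece i) ⊥ relativeInterior (piece j))
    where module I = Setoid I

  FinS : ℕ → Setoid 0ℓ 0ℓ
  FinS k = ≡.setoid (Fin k)

  -- P is the disjoint union of k pairwise congruent pieces, each satisfying Q.
  ComposedOfCongruent : ∀ {q} → ℕ → (PointSet N → Set q) → PointSet N → Set (q ⊔ lsuc 0ℓ)
  ComposedOfCongruent {N} k Q P = Σ (Fin k → PointSet N) λ piece →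
    IsDisjointUnion P (FinS k) piece ×
    (∀ i → Q (piece i)) ×
    (∀ i j → piece i ≅ piece j)

  HasCardinality : Setoid 0ℓ 0ℓ → ℕ → Set
  HasCardinality I k = Inverse (FinS k) I

  --------------------------------------------------------------------------
  -- Matrices

  Matrix : ℕ → Set
  Matrix n = Vector (Vector R n) n

  matrixSetoid : ℕ → Setoid 0ℓ 0ℓ
  matrixSetoid n = VectorEquality.≋-setoid (≋-setoid n) n

  infix 4 _≋ₘ_
  _≋ₘ_ : Matrix n → Matrix n → Set
  _≋ₘ_ {n} = Setoid._≈_ (matrixSetoid n)

  subsetoid : Pred (Matrix n) 0ℓ → Setoid 0ℓ 0ℓ
  subsetoid {n} S = On.setoid {B = ∃ S} (matrixSetoid n) proj₁

  infixr 8 _*ᵥ_ _*ₛ_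

  _*ᵥ_ : Matrix n → Point n → Point n
  (M *ᵥ x) i = sum (λ j → M i j * x j)

  _*ₛ_ : Matrix n → PointSet n → PointSet n
  M *ₛ P = image (M *ᵥ_) P

  -- Column j is the unit vector at π j.
  permutationMatrix : Permutation′ n → Matrix n
  permutationMatrix π i j = δ i (π ⟨$⟩ʳ j)

  -- The block matrix with diagonal blocks M and 1.
  bordered : Matrix n → Matrix (suc n)
  bordered M i j with view i | view j
  ... | ‵inject₁ i′ | ‵inject₁ j′ = M i′ j′
  ... | ‵fromℕ      | ‵fromℕ      = 1#
  ... | ‵inject₁ _  | ‵fromℕ      = 0#
  ... | ‵fromℕ      | ‵inject₁ _  = 0#

  G₁ : (n : ℕ) → Pred (Matrix (suc n)) 0ℓ
  G₁ n M = ∃ λ (π : Permutation′ n) → M ≋ₘ bordered (permutationMatrix π)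

  Γ : (m : ℕ) → .{{ℕ.NonZero m}} → Fin m → Matrix m
  Γ m s i j = δ i ((toℕ j ℕ.+ toℕ s) mod m)

  C : (m : ℕ) → .{{ℕ.NonZero m}} → Pred (Matrix m) 0ℓ
  C m M = ∃ λ s → M ≋ₘ Γ m s

  --------------------------------------------------------------------------
  -- The lattice A n in ℝ^(n+1).  Indices 1, …, n+1 are represented by
  -- 0, …, n : Fin (suc n), so that the index n+1 is fromℕ n.

  H : (n : ℕ) → PointSet (suc n)
  H n x = x ∙ 𝟏 ≈ 0#

  A : (n : ℕ) → PointSet (suc n)
  A n x = (∀ i → ∃ λ z → x i ≈ fromℤ z) × x ∈ H n

  V : (n : ℕ) → PointSet (suc n)
  V n x = x ∈ H n × (∀ q → q ∈ A n → ‖ x ‖ ≤ ‖ x -ᵥ q ‖)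

  ξ : (n : ℕ) → Vector (Point (suc n)) (suc n)
  ξ n i k = e i k - (suc n ·ℕ 1#) ⁻¹ * 𝟏 {suc n} k

  ◇ : (n : ℕ) → Fin (suc n) → PointSet (suc n)
  ◇ n j = parallelepiped 0ᵥ (removeAt (ξ n) j)

  -- v n j is the sum of the first j of the ξ n i.
  v : (n : ℕ) → Vector (Point (suc n)) (suc n)
  v n j k = sum (λ (i : Fin′ j) → ξ n (inject i) k)

  σ₀ : (n : ℕ) → PointSet (suc n)
  σ₀ n = convexHull (v n)

{-# OPTIONS --safe #-}
-- Since the ξ i sum to 0, a point of H is a combination of the ξ i whose
-- coefficients are determined up to a common constant by the coordinates.
-- Hence all cells are cut out of H by conditions on coordinate differences:
--   V    x i - x j ≤ 1 for all i, j
--   ◇ j  x i - x j ∈ [0, 1] for all i, so that x j is the least coordinate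
--   ρ σ₀ x (ρ i) - x (ρ j) ∈ [0, 1] for i ≤ j, so that ρ sorts the coordinates
-- The unions amount to choosing a least coordinate and to sorting.  In a
-- relative interior the inequalities are strict, so that the least index and
-- the sorting permutation are unique.
--
-- The inner products ξ i ∙ ξ j = δ i j - 1/(n+1) give the hyper-rhombi: a
-- facet of a parallelepiped fixes exactly one coefficient at 0 or 1, and the
-- reflection orthogonal to ξ i - ξ j exchanges ξ i and ξ j and fixes the other
-- generators, so it carries facets to facets.
module Submission where

open import Defs
import Algebra.Properties.Ring as RingProperties
import Algebra.Properties.Semiring.Mult.TCOptimised as OptimisedMult
import Algebra.Properties.Semiring.Sum as SemiringSum
import Algebra.Solver.Ring as RingSolver
open import Algebra.Solver.Ring.AlmostCommutativeRing using (fromCommutativeRing; _-Raw-AlmostCommutative⟶_; Induced-equivalence)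
open import Data.Bool.Base using (true; false; if_then_else_)
open import Data.Fin.Base as Fin using (Fin; Fin′; zero; suc; toℕ; fromℕ; inject; inject₁; punchIn; punchOut; combine; remQuot)
open import Data.Fin.Permutation as Perm using (Permutation′; _⟨$⟩ʳ_; _⟨$⟩ˡ_; _∘ₚ_)
import Data.Fin.Properties as Finₚ
open import Data.Fin.Properties using (_≟_; any?; punchIn-punchOut; punchIn-injective)
open import Data.Fin.Relation.Unary.Top using (view; ‵fromℕ; ‵inject₁)
open import Data.Integer.Base as ℤ using (ℤ; +_; -[1+_]; +[1+_]; +0; _⊖_; _◃_)
import Data.Integer.Properties as ℤₚ
open import Data.Maybe.Base using (just; nothing)
open import Data.Nat.Base as ℕ using (ℕ; zero; suc; z≤n; s≤s; _∸_; _%_; _<ᵇ_; _≥_; _!)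
import Data.Nat.DivMod as DivMod
open import Data.Nat.DivMod using (_mod_)
import Data.Nat.Properties as ℕₚ
open import Data.Product using (∃; _×_; _,_; proj₁; proj₂; map₂)
open import Data.Sign.Base as Sign using (Sign)
open import Data.Sum.Base using (inj₁; inj₂)
open import Data.Vec.Functional using (Vector; insertAt; removeAt)
open import Data.Vec.Functional.Properties using (insertAt-lookup; insertAt-punchIn)
open import Function.Base using (_∘_; id)
open import Level using (0ℓ)
open import Relation.Binary.Core using (Rel)
open import Relation.Binary.Definitions using (Asymmetric; WeaklyDecidable; tri<; tri≈; tri>)
open import Relation.Binary.PropositionalEquality as ≡ using (_≡_; _≢_; module ≡-Reasoning)
open import Relation.Nullary using (¬_; yes; no; does; contradiction; ¬?)
open import Relation.Nullary.Decidable using (dec-true; dec-false; decidable-stable)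
open import Relation.Unary using (_∈_; _⊆_; _≐_; ⋃)
open import Relation.Unary.Properties using (≐-sym; ≐-trans)

-- Only the description of `V` involves the lattice. Necessity needs just the vectors e i - e j.
-- Sufficiency for every q rests on q² ≥ |q| for integers, applied coordinatewise after subtracting
-- from x its least coordinate; this changes nothing because the coordinates of q sum to 0. Relative
-- interiors are used in one way: an interior point x can be pushed slightly past itself, away from
-- any point q of the set. An inequality valid on the set and strict at one q is therefore strict at
-- x, and a vertex serves as q. A face comes with an arbitrary supporting functional, and its
-- dimension is a count of affinely independent points, so facets have to be classified from both
-- sides. A functional vanishing on all generators leaves too many independent points; one that is
-- nonzero on two generators leaves too few, by counting equations against unknowns. Norms are
-- square roots defined as suprema. Once `√_` is known to preserve and reflect order, every metric
-- statement becomes a polynomial identity or inequality about squared norms.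

module FinitePermutations where

  private
    variable
      n : ℕ

  -- Enumeration of the permutations by `Fin (n !)`

  insert-cong : ∀ i j {π ρ : Permutation′ n} → π Perm.≈ ρ → Perm.insert i j π Perm.≈ Perm.insert i j ρ
  insert-cong i j π≈ρ k with i ≟ k
  ... | yes _   = ≡.refl
  ... | no  i≢k = ≡.cong (punchIn j) (π≈ρ (punchOut i≢k))

  insert-lookup : ∀ i j (π : Permutation′ n) → Perm.insert i j π ⟨$⟩ʳ i ≡ j
  insert-lookup i j π with i ≟ i
  ... | yes _   = ≡.refl
  ... | no  i≢i = contradiction ≡.refl i≢i

  remove-cong : ∀ i {π ρ : Permutation′ (suc n)} → π Perm.≈ ρ → Perm.remove i π Perm.≈ Perm.remove i ρ
  remove-cong i {π} {ρ} π≈ρ k = Finₚ.punchIn-injective (π ⟨$⟩ʳ i) _ _ (begin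
    punchIn (π ⟨$⟩ʳ i) (Perm.remove i π ⟨$⟩ʳ k)  ≡⟨ Perm.punchIn-permute π i k ⟨
    π ⟨$⟩ʳ punchIn i k                           ≡⟨ π≈ρ (punchIn i k) ⟩
    ρ ⟨$⟩ʳ punchIn i k                           ≡⟨ Perm.punchIn-permute ρ i k ⟩
    punchIn (ρ ⟨$⟩ʳ i) (Perm.remove i ρ ⟨$⟩ʳ k)  ≡⟨ ≡.cong (λ j → punchIn j (Perm.remove i ρ ⟨$⟩ʳ k)) (π≈ρ i) ⟨
    punchIn (π ⟨$⟩ʳ i) (Perm.remove i ρ ⟨$⟩ʳ k)  ∎)
    where open ≡-Reasoning

  prepend : Fin (suc n) × Permutation′ n → Permutation′ (suc n)
  prepend (j , π) = Perm.insert zero j π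

  -- The factorial number system: the leading digit is the image of `zero`, and the remaining digits
  -- encode the permutation left when `zero` and its image are removed.
  enumerate : ∀ n → Fin (n !) → Permutation′ n
  enumerate zero    _ = Perm.id
  enumerate (suc n) k = prepend (map₂ (enumerate n) (remQuot (n !) k))

  index : ∀ n → Permutation′ n → Fin (n !)
  index zero    _ = zero
  index (suc n) π = combine (π ⟨$⟩ʳ zero) (index n (Perm.remove zero π))

  index-cong : ∀ n {π ρ : Permutation′ n} → π Perm.≈ ρ → index n π ≡ index n ρ
  index-cong zero    π≈ρ = ≡.refl
  index-cong (suc n) {π} {ρ} π≈ρ = ≡.cong₂ combine (π≈ρ zero) (index-cong n (remove-cong zero {π} {ρ} π≈ρ))

  enumerate-index : ∀ n (π : Permutation′ n) → enumerate n (index n π) Perm.≈ π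
  enumerate-index (suc n) π k = begin
    prepend (map₂ (enumerate n) (remQuot (n !) (index (suc n) π))) ⟨$⟩ʳ k
      ≡⟨ ≡.cong (λ p → prepend (map₂ (enumerate n) p) ⟨$⟩ʳ k) (Finₚ.remQuot-combine π₀ (index n π/0)) ⟩
    Perm.insert zero π₀ (enumerate n (index n π/0)) ⟨$⟩ʳ k
      ≡⟨ insert-cong zero π₀ {enumerate n (index n π/0)} {π/0} (enumerate-index n π/0) k ⟩
    Perm.insert zero π₀ π/0 ⟨$⟩ʳ k
      ≡⟨ Perm.insert-remove zero π k ⟩
    π ⟨$⟩ʳ k ∎
    where
    open ≡-Reasoning
    π₀ = π ⟨$⟩ʳ zero
    π/0 = Perm.remove zero π

  index-enumerate : ∀ n (k : Fin (n !)) → index n (enumerate n k) ≡ k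
  index-enumerate zero    zero = ≡.refl
  index-enumerate (suc n) k = ≡.trans
    (≡.cong (combine q) (≡.trans
      (index-cong n {Perm.remove zero (Perm.insert zero q (enumerate n r))} (Perm.remove-insert zero q (enumerate n r)))
      (index-enumerate n r)))
    (Finₚ.combine-remQuot {suc n} (n !) k)
    where
    q = proj₁ (remQuot {suc n} (n !) k)
    r = proj₂ (remQuot {suc n} (n !) k)

  -- Permutations fixing the last index

  -- The counterpart of `bordered` on permutations.
  extend : Permutation′ n → Permutation′ (suc n)
  extend {n} = Perm.insert (fromℕ n) (fromℕ n)

  punchIn-fromℕ : (k : Fin n) → punchIn (fromℕ n) k ≡ inject₁ k
  punchIn-fromℕ zero    = ≡.refl
  punchIn-fromℕ (suc k) = ≡.cong suc (punchIn-fromℕ k)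

  extend-fromℕ : (π : Permutation′ n) → extend π ⟨$⟩ʳ fromℕ n ≡ fromℕ n
  extend-fromℕ {n} = insert-lookup (fromℕ n) (fromℕ n)

  extend-inject₁ : (π : Permutation′ n) (k : Fin n) → extend π ⟨$⟩ʳ inject₁ k ≡ inject₁ (π ⟨$⟩ʳ k)
  extend-inject₁ {n} π k = begin
    extend π ⟨$⟩ʳ inject₁ k            ≡⟨ ≡.cong (extend π ⟨$⟩ʳ_) (punchIn-fromℕ k) ⟨
    extend π ⟨$⟩ʳ punchIn (fromℕ n) k  ≡⟨ Perm.insert-punchIn (fromℕ n) (fromℕ n) π k ⟩
    punchIn (fromℕ n) (π ⟨$⟩ʳ k)       ≡⟨ punchIn-fromℕ (π ⟨$⟩ʳ k) ⟩
    inject₁ (π ⟨$⟩ʳ k)                 ∎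
    where open ≡-Reasoning

  extend-injective : {π ρ : Permutation′ n} → extend π Perm.≈ extend ρ → π Perm.≈ ρ
  extend-injective {π = π} {ρ} eq k = Finₚ.inject₁-injective
    (≡.trans (≡.sym (extend-inject₁ π k)) (≡.trans (eq (inject₁ k)) (extend-inject₁ ρ k)))

  -- Uniqueness of the sorting permutation

  strictMono⇒≤ : (f : Fin n → Fin n) → (∀ {i j} → i Fin.< j → f i Fin.< f j) → ∀ i → i Fin.≤ f i
  strictMono⇒≤ {n} f mono i = go (toℕ i) i ≡.refl
    where
    -- The recursion is on the value of i, since the predecessor `inject₁ i` of `suc i` is not a
    -- subterm of it.
    go : ∀ k (i : Fin n) → toℕ i ≡ k → k ℕ.≤ toℕ (f i)
    go zero    i       eq = z≤n
    go (suc k) (suc i) eq = ℕₚ.≤-<-trans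
      (go k (inject₁ i) (≡.trans (Finₚ.toℕ-inject₁ i) (ℕₚ.suc-injective eq)))
      (mono (ℕ.s≤s (ℕₚ.≤-reflexive (Finₚ.toℕ-inject₁ i))))

  permutation-injective : (π : Permutation′ n) {i j : Fin n} → π ⟨$⟩ʳ i ≡ π ⟨$⟩ʳ j → i ≡ j
  permutation-injective π {i} {j} eq = begin
    i                       ≡⟨ Perm.inverseˡ π ⟨
    π ⟨$⟩ˡ (π ⟨$⟩ʳ i)       ≡⟨ ≡.cong (π ⟨$⟩ˡ_) eq ⟩
    π ⟨$⟩ˡ (π ⟨$⟩ʳ j)       ≡⟨ Perm.inverseˡ π ⟩
    j                       ∎
    where open ≡-Reasoning

  module _ {n : ℕ} {_≺_ : Rel (Fin n) 0ℓ} (asym : Asymmetric _≺_) where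

    Increasing : Permutation′ n → Set
    Increasing π = ∀ {i j} → i Fin.< j → (π ⟨$⟩ʳ i) ≺ (π ⟨$⟩ʳ j)

    -- The composite ρ⁻¹ ∘ π is strictly monotone: if it reversed some i < j, then ρ would order π i
    -- and π j opposite to π, against asymmetry.
    increasing-≤ : (π ρ : Permutation′ n) → Increasing π → Increasing ρ → ∀ i → i Fin.≤ ρ ⟨$⟩ˡ (π ⟨$⟩ʳ i)
    increasing-≤ π ρ π-inc ρ-inc = strictMono⇒≤ f mono
      where
      f : Fin n → Fin n
      f i = ρ ⟨$⟩ˡ (π ⟨$⟩ʳ i)
      ρf≡π : ∀ i → ρ ⟨$⟩ʳ f i ≡ π ⟨$⟩ʳ i
      ρf≡π i = Perm.inverseʳ ρ
      mono : ∀ {i j} → i Fin.< j → f i Fin.< f j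
      mono {i} {j} i<j with Finₚ.<-cmp (f i) (f j)
      ... | tri< fi<fj _ _ = fi<fj
      ... | tri≈ _ fi≡fj _ = contradiction
              (permutation-injective π (≡.trans (≡.sym (ρf≡π i)) (≡.trans (≡.cong (ρ ⟨$⟩ʳ_) fi≡fj) (ρf≡π j))))
              (Finₚ.<⇒≢ i<j)
      ... | tri> _ _ fj<fi = contradiction (π-inc i<j)
              (asym (≡.subst₂ _≺_ (ρf≡π j) (ρf≡π i) (ρ-inc fj<fi)))

    -- Both ρ⁻¹ ∘ π and its inverse π⁻¹ ∘ ρ dominate the identity, so both are the identity.
    increasing-unique : (π ρ : Permutation′ n) → Increasing π → Increasing ρ → π Perm.≈ ρ
    increasing-unique π ρ π-inc ρ-inc i = begin
      π ⟨$⟩ʳ i                      ≡⟨ Perm.inverseʳ ρ ⟨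
      ρ ⟨$⟩ʳ (ρ ⟨$⟩ˡ (π ⟨$⟩ʳ i))    ≡⟨ ≡.cong (ρ ⟨$⟩ʳ_) (Finₚ.≤-antisym below (increasing-≤ π ρ π-inc ρ-inc i)) ⟩
      ρ ⟨$⟩ʳ i                      ∎
      where
      open ≡-Reasoning
      below : ρ ⟨$⟩ˡ (π ⟨$⟩ʳ i) Fin.≤ i
      below = ≡.subst (ρ ⟨$⟩ˡ (π ⟨$⟩ʳ i) Fin.≤_)
        (≡.trans (≡.cong (π ⟨$⟩ˡ_) (Perm.inverseʳ ρ)) (Perm.inverseˡ π))
        (increasing-≤ ρ π ρ-inc π-inc (ρ ⟨$⟩ˡ (π ⟨$⟩ʳ i)))

  -- Cyclic shifts

  toℕ-mod : ∀ a m .{{_ : ℕ.NonZero m}} → toℕ (a mod m) ≡ a % m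
  toℕ-mod a m = Finₚ.toℕ-fromℕ< (DivMod.m%n<n a m)

  mod-cong : ∀ {a b} m .{{_ : ℕ.NonZero m}} → a % m ≡ b % m → a mod m ≡ b mod m
  mod-cong {a} {b} m eq = Finₚ.toℕ-injective (≡.trans (toℕ-mod a m) (≡.trans eq (≡.sym (toℕ-mod b m))))

  toℕ-mod-+ : ∀ a b m .{{_ : ℕ.NonZero m}} → (toℕ (a mod m) ℕ.+ b) mod m ≡ (a ℕ.+ b) mod m
  toℕ-mod-+ a b m = mod-cong m (begin
    (toℕ (a mod m) ℕ.+ b) % m    ≡⟨ ≡.cong (λ k → (k ℕ.+ b) % m) (toℕ-mod a m) ⟩
    (a % m ℕ.+ b) % m            ≡⟨ DivMod.%-distribˡ-+ (a % m) b m ⟩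
    (a % m % m ℕ.+ b % m) % m    ≡⟨ ≡.cong (λ k → (k ℕ.+ b % m) % m) (DivMod.m%n%n≡m%n a m) ⟩
    (a % m ℕ.+ b % m) % m        ≡⟨ DivMod.%-distribˡ-+ a b m ⟨
    (a ℕ.+ b) % m                ∎)
    where open ≡-Reasoning

  +-toℕ-mod : ∀ a b m .{{_ : ℕ.NonZero m}} → (a ℕ.+ toℕ (b mod m)) mod m ≡ (a ℕ.+ b) mod m
  +-toℕ-mod a b m = begin
    (a ℕ.+ toℕ (b mod m)) mod m  ≡⟨ ≡.cong (_mod m) (ℕₚ.+-comm a _) ⟩
    (toℕ (b mod m) ℕ.+ a) mod m  ≡⟨ toℕ-mod-+ b a m ⟩
    (b ℕ.+ a) mod m              ≡⟨ ≡.cong (_mod m) (ℕₚ.+-comm b a) ⟩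
    (a ℕ.+ b) mod m              ∎
    where open ≡-Reasoning

  toℕ+m-mod-m : ∀ m .{{_ : ℕ.NonZero m}} (i : Fin m) → (toℕ i ℕ.+ m) mod m ≡ i
  toℕ+m-mod-m m i = Finₚ.toℕ-injective (begin
    toℕ ((toℕ i ℕ.+ m) mod m)  ≡⟨ toℕ-mod (toℕ i ℕ.+ m) m ⟩
    (toℕ i ℕ.+ m) % m          ≡⟨ DivMod.[m+n]%n≡m%n (toℕ i) m ⟩
    toℕ i % m                  ≡⟨ DivMod.m<n⇒m%n≡m (Finₚ.toℕ<n i) ⟩
    toℕ i                      ∎)
    where open ≡-Reasoning

  -- Chosen so that `permutationMatrix (shift m s)` unfolds to `Γ m s`; the inverse adds m - s
  -- instead of s.
  shift : ∀ m .{{_ : ℕ.NonZero m}} → Fin m → Permutation′ m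
  shift m s = Perm.permutation to from to-from from-to
    where
    open ≡-Reasoning
    s≤m : toℕ s ℕ.≤ m
    s≤m = ℕₚ.<⇒≤ (Finₚ.toℕ<n s)
    to from : Fin m → Fin m
    to   i = (toℕ i ℕ.+ toℕ s) mod m
    from i = (toℕ i ℕ.+ (m ∸ toℕ s)) mod m
    to-from : ∀ i → to (from i) ≡ i
    to-from i = begin
      to (from i)                                   ≡⟨ toℕ-mod-+ (toℕ i ℕ.+ (m ∸ toℕ s)) (toℕ s) m ⟩
      (toℕ i ℕ.+ (m ∸ toℕ s) ℕ.+ toℕ s) mod m       ≡⟨ ≡.cong (_mod m) (ℕₚ.+-assoc (toℕ i) (m ∸ toℕ s) (toℕ s)) ⟩
      (toℕ i ℕ.+ (m ∸ toℕ s ℕ.+ toℕ s)) mod m       ≡⟨ ≡.cong (λ k → (toℕ i ℕ.+ k) mod m) (ℕₚ.m∸n+n≡m s≤m) ⟩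
      (toℕ i ℕ.+ m) mod m                           ≡⟨ toℕ+m-mod-m m i ⟩
      i                                             ∎
    from-to : ∀ i → from (to i) ≡ i
    from-to i = begin
      from (to i)                                   ≡⟨ toℕ-mod-+ (toℕ i ℕ.+ toℕ s) (m ∸ toℕ s) m ⟩
      (toℕ i ℕ.+ toℕ s ℕ.+ (m ∸ toℕ s)) mod m       ≡⟨ ≡.cong (_mod m) (ℕₚ.+-assoc (toℕ i) (toℕ s) (m ∸ toℕ s)) ⟩
      (toℕ i ℕ.+ (toℕ s ℕ.+ (m ∸ toℕ s))) mod m     ≡⟨ ≡.cong (λ k → (toℕ i ℕ.+ k) mod m) (ℕₚ.m+[n∸m]≡n s≤m) ⟩
      (toℕ i ℕ.+ m) mod m                           ≡⟨ toℕ+m-mod-m m i ⟩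
      i                                             ∎

  shift-zero : ∀ m (s : Fin (suc m)) → shift (suc m) s ⟨$⟩ʳ zero ≡ s
  shift-zero m s = Finₚ.toℕ-injective (≡.trans (toℕ-mod (toℕ s) (suc m)) (DivMod.m<n⇒m%n≡m (Finₚ.toℕ<n s)))

  -- The index j counts from 0, so its hyper-rhombus has number j + 1, and n + (j + 1) is j modulo n
  -- + 1.
  shift-fromℕ : ∀ n (j : Fin (suc n)) → shift (suc n) (suc (toℕ j) mod suc n) ⟨$⟩ʳ fromℕ n ≡ j
  shift-fromℕ n j = begin
    (toℕ (fromℕ n) ℕ.+ toℕ (suc (toℕ j) mod suc n)) mod suc n  ≡⟨ +-toℕ-mod (toℕ (fromℕ n)) (suc (toℕ j)) (suc n) ⟩
    (toℕ (fromℕ n) ℕ.+ suc (toℕ j)) mod suc n                  ≡⟨ ≡.cong (λ k → (k ℕ.+ suc (toℕ j)) mod suc n) (Finₚ.toℕ-fromℕ n) ⟩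
    (n ℕ.+ suc (toℕ j)) mod suc n                              ≡⟨ ≡.cong (_mod suc n) (≡.trans (ℕₚ.+-suc n (toℕ j)) (ℕₚ.+-comm (suc n) (toℕ j))) ⟩
    (toℕ j ℕ.+ suc n) mod suc n                                ≡⟨ toℕ+m-mod-m (suc n) j ⟩
    j                                                          ∎
    where open ≡-Reasoning

  shift-fromℕ-injective : ∀ n (s s′ : Fin (suc n)) →
    shift (suc n) s ⟨$⟩ʳ fromℕ n ≡ shift (suc n) s′ ⟨$⟩ʳ fromℕ n → s ≡ s′
  shift-fromℕ-injective n s s′ eq =
    ≡.trans (≡.sym (recover s)) (≡.trans (≡.cong (λ i → (toℕ i ℕ.+ 1) mod suc n) eq) (recover s′))
    where
    open ≡-Reasoning
    -- The last index is -1 modulo n + 1, so adding 1 to its image gives back the shift.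
    recover : ∀ s → (toℕ (shift (suc n) s ⟨$⟩ʳ fromℕ n) ℕ.+ 1) mod suc n ≡ s
    recover s = begin
      (toℕ ((toℕ (fromℕ n) ℕ.+ toℕ s) mod suc n) ℕ.+ 1) mod suc n  ≡⟨ toℕ-mod-+ (toℕ (fromℕ n) ℕ.+ toℕ s) 1 (suc n) ⟩
      (toℕ (fromℕ n) ℕ.+ toℕ s ℕ.+ 1) mod suc n                    ≡⟨ ≡.cong (λ k → (k ℕ.+ toℕ s ℕ.+ 1) mod suc n) (Finₚ.toℕ-fromℕ n) ⟩
      (n ℕ.+ toℕ s ℕ.+ 1) mod suc n                                ≡⟨ ≡.cong (_mod suc n) (ℕₚ.+-comm (n ℕ.+ toℕ s) 1) ⟩
      (suc n ℕ.+ toℕ s) mod suc n                                  ≡⟨ ≡.cong (_mod suc n) (ℕₚ.+-comm (suc n) (toℕ s)) ⟩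
      (toℕ s ℕ.+ suc n) mod suc n                                  ≡⟨ toℕ+m-mod-m (suc n) s ⟩
      s                                                            ∎

-- Arithmetic in an ordered field

module Ordered (ℝ : CompleteOrderedField) where

  open CompleteOrderedField ℝ public hiding (zero) renaming (Carrier to R)
  open RingProperties ring public using (-‿involutive; -0#≈0#; -‿+-comm; -‿distribˡ-*; -‿distribʳ-*)
  open OptimisedMult semiring using (×-homo-+; ×1-homo-*) renaming (_×_ to _×′_)

  private
    -- Integer coefficients for the ring solver. The optimised multiple makes `1 ×′ 1#` reduce to
    -- `1#`, so that `con (+ 1)` stands for `1#` itself.
    module Coefficients where
      ⟦_⟧ᶻ : ℤ → R
      ⟦ + n ⟧ᶻ      = n ×′ 1#
      ⟦ -[1+ n ] ⟧ᶻ = - (suc n ×′ 1#)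

      open import Relation.Binary.Reasoning.Setoid setoid

      -‿homo : ∀ i → ⟦ ℤ.- i ⟧ᶻ ≈ - ⟦ i ⟧ᶻ
      -‿homo +0       = sym -0#≈0#
      -‿homo +[1+ n ] = refl
      -‿homo -[1+ n ] = sym (-‿involutive _)

      x≈x+0-0 : ∀ x → x ≈ x - 0#
      x≈x+0-0 x = sym (trans (+-congˡ -0#≈0#) (+-identityʳ x))

      ⊖-homo : ∀ m n → ⟦ m ⊖ n ⟧ᶻ ≈ m ×′ 1# - n ×′ 1#
      ⊖-homo zero    zero    = x≈x+0-0 0#
      ⊖-homo zero    (suc n) = sym (+-identityˡ _)
      ⊖-homo (suc m) zero    = x≈x+0-0 _
      ⊖-homo (suc m) (suc n) = begin
        ⟦ suc m ⊖ suc n ⟧ᶻ                        ≡⟨ ≡.cong ⟦_⟧ᶻ (ℤₚ.[1+m]⊖[1+n]≡m⊖n m n) ⟩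
        ⟦ m ⊖ n ⟧ᶻ                                ≈⟨ ⊖-homo m n ⟩
        m ×′ 1# - n ×′ 1#                         ≈⟨ +-congʳ (+-identityˡ _) ⟨
        0# + m ×′ 1# - n ×′ 1#                    ≈⟨ +-congʳ (+-congʳ (-‿inverseʳ 1#)) ⟨
        1# - 1# + m ×′ 1# - n ×′ 1#               ≈⟨ +-congʳ (trans (+-assoc _ _ _) (trans (+-congˡ (+-comm _ _)) (sym (+-assoc _ _ _)))) ⟩
        1# + m ×′ 1# - 1# - n ×′ 1#               ≈⟨ +-assoc _ _ _ ⟩
        1# + m ×′ 1# + (- 1# - n ×′ 1#)           ≈⟨ +-congˡ (-‿+-comm _ _) ⟩
        1# + m ×′ 1# - (1# + n ×′ 1#)             ≈⟨ +-cong (sym (×-homo-+ 1# 1 m)) (-‿cong (sym (×-homo-+ 1# 1 n))) ⟩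
        suc m ×′ 1# - suc n ×′ 1#                 ∎

      +-homo : ∀ i j → ⟦ i ℤ.+ j ⟧ᶻ ≈ ⟦ i ⟧ᶻ + ⟦ j ⟧ᶻ
      +-homo (+ m)      (+ n)      = ×-homo-+ 1# m n
      +-homo (+ m)      -[1+ n ]   = ⊖-homo m (suc n)
      +-homo -[1+ m ]   (+ n)      = trans (⊖-homo n (suc m)) (+-comm _ _)
      +-homo -[1+ m ]   -[1+ n ]   = begin
        - (suc (suc (m ℕ.+ n)) ×′ 1#)             ≡⟨ ≡.cong (λ k → - (k ×′ 1#)) (ℕ-suc m n) ⟩
        - ((suc m ℕ.+ suc n) ×′ 1#)               ≈⟨ -‿cong (×-homo-+ 1# (suc m) (suc n)) ⟩
        - (suc m ×′ 1# + suc n ×′ 1#)             ≈⟨ -‿+-comm _ _ ⟨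
        - (suc m ×′ 1#) - suc n ×′ 1#             ∎
        where
        ℕ-suc : ∀ m n → suc (suc (m ℕ.+ n)) ≡ suc m ℕ.+ suc n
        ℕ-suc zero    n = ≡.refl
        ℕ-suc (suc m) n = ≡.cong suc (ℕ-suc m n)

      -◃-homo : ∀ n → ⟦ Sign.- ◃ n ⟧ᶻ ≈ - (n ×′ 1#)
      -◃-homo zero    = sym -0#≈0#
      -◃-homo (suc n) = refl

      +◃-homo : ∀ n → ⟦ Sign.+ ◃ n ⟧ᶻ ≈ n ×′ 1#
      +◃-homo zero    = refl
      +◃-homo (suc n) = refl

      *-homo : ∀ i j → ⟦ i ℤ.* j ⟧ᶻ ≈ ⟦ i ⟧ᶻ * ⟦ j ⟧ᶻ
      *-homo (+ m)      (+ n)      = trans (+◃-homo (m ℕ.* n)) (×1-homo-* m n)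
      *-homo (+ m)      -[1+ n ]   =
        trans (-◃-homo (m ℕ.* suc n)) (trans (-‿cong (×1-homo-* m (suc n))) (-‿distribʳ-* _ _))
      *-homo -[1+ m ]   (+ n)      =
        trans (-◃-homo (suc m ℕ.* n)) (trans (-‿cong (×1-homo-* (suc m) n)) (-‿distribˡ-* _ _))
      *-homo -[1+ m ]   -[1+ n ]   = begin
        ⟦ Sign.+ ◃ (suc m ℕ.* suc n) ⟧ᶻ           ≈⟨ +◃-homo (suc m ℕ.* suc n) ⟩
        (suc m ℕ.* suc n) ×′ 1#                   ≈⟨ ×1-homo-* (suc m) (suc n) ⟩
        suc m ×′ 1# * suc n ×′ 1#                 ≈⟨ -‿involutive _ ⟨
        - - (suc m ×′ 1# * suc n ×′ 1#)           ≈⟨ -‿cong (-‿distribˡ-* _ _) ⟩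
        - (- (suc m ×′ 1#) * suc n ×′ 1#)         ≈⟨ -‿distribʳ-* _ _ ⟩
        - (suc m ×′ 1#) * - (suc n ×′ 1#)         ∎

      morphism : ℤ.+-*-rawRing -Raw-AlmostCommutative⟶ fromCommutativeRing commutativeRing
      morphism = record
        { ⟦_⟧    = ⟦_⟧ᶻ
        ; +-homo = +-homo
        ; *-homo = *-homo
        ; -‿homo = -‿homo
        ; 0-homo = refl
        ; 1-homo = refl
        }

      _coeff≟_ : WeaklyDecidable (Induced-equivalence morphism)
      i coeff≟ j with i ℤₚ.≟ j
      ... | yes i≡j = just (reflexive (≡.cong ⟦_⟧ᶻ i≡j))
      ... | no  _   = nothing

  module Solver = RingSolver ℤ.+-*-rawRing (fromCommutativeRing commutativeRing)
                    Coefficients.morphism Coefficients._coeff≟_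
  open Solver public using (solve; _:=_; _:+_; _:*_; _:-_; :-_; con)

  x-y≈0⇒x≈y : ∀ {x y} → x - y ≈ 0# → x ≈ y
  x-y≈0⇒x≈y {x} {y} eq = trans (solve 2 (λ x y → x := (x :- y) :+ y) refl x y)
                         (trans (+-congʳ eq) (+-identityˡ y))

  x≈y⇒x-y≈0 : ∀ {x y} → x ≈ y → x - y ≈ 0#
  x≈y⇒x-y≈0 {x} {y} eq = trans (+-congʳ eq) (-‿inverseʳ y)

  -- Lets the ring solver use the equation a ≈ b.
  modulo : ∀ {a b x y} c → a ≈ b → x - y ≈ c * (a - b) → x ≈ y
  modulo c a≈b eq = x-y≈0⇒x≈y (trans eq (trans (*-congˡ (x≈y⇒x-y≈0 a≈b)) (zeroʳ c)))

  x≤y⇒0≤y-x : ∀ {x y} → x ≤ y → 0# ≤ y - x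
  x≤y⇒0≤y-x {x} x≤y = ≤.≤-respˡ-≈ (-‿inverseʳ x) (+-monoˡ-≤ (- x) x≤y)

  -- The form in which most later inequalities are proved: the difference is written as a visibly
  -- nonnegative expression, and the identity is left to the ring solver.
  ≤-by : ∀ {x y d} → 0# ≤ d → y - x ≈ d → x ≤ y
  ≤-by {x} {y} 0≤d eq = ≤.≤-respˡ-≈ (+-identityˡ x)
    (≤.≤-respʳ-≈ (solve 2 (λ x y → (y :- x) :+ x := y) refl x y)
    (+-monoˡ-≤ x (≤.≤-respʳ-≈ (sym eq) 0≤d)))

  +-nonNeg : ∀ {x y} → 0# ≤ x → 0# ≤ y → 0# ≤ x + y
  +-nonNeg {x} {y} 0≤x 0≤y =
    ≤.trans 0≤y (≤.≤-respˡ-≈ (+-identityˡ y) (+-monoˡ-≤ y 0≤x))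

  +-mono-≤ : ∀ {x y u v} → x ≤ y → u ≤ v → x + u ≤ y + v
  +-mono-≤ {x} {y} {u} {v} x≤y u≤v = ≤-by (+-nonNeg (x≤y⇒0≤y-x x≤y) (x≤y⇒0≤y-x u≤v))
    (solve 4 (λ x y u v → (y :+ v) :- (x :+ u) := (y :- x) :+ (v :- u)) refl x y u v)

  *-monoʳ-≤ : ∀ {x y} z → 0# ≤ z → x ≤ y → z * x ≤ z * y
  *-monoʳ-≤ {x} {y} z 0≤z x≤y = ≤-by (*-nonNeg 0≤z (x≤y⇒0≤y-x x≤y))
    (solve 3 (λ x y z → z :* y :- z :* x := z :* (y :- x)) refl x y z)

  0≤x² : ∀ x → 0# ≤ x * x
  0≤x² x with ≤.total 0# x
  ... | inj₁ 0≤x = *-nonNeg 0≤x 0≤x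
  ... | inj₂ x≤0 = ≤.≤-respʳ-≈ (solve 1 (λ x → (con (+ 0) :- x) :* (con (+ 0) :- x) := x :* x) refl x)
                     (*-nonNeg (x≤y⇒0≤y-x x≤0) (x≤y⇒0≤y-x x≤0))

  0≤1 : 0# ≤ 1#
  0≤1 = ≤.≤-respʳ-≈ (*-identityˡ 1#) (0≤x² 1#)

  0<1 : 0# < 1#
  0<1 = 0≤1 , 0≉1

  ≰⇒> : ∀ {x y} → ¬ x ≤ y → y < x
  ≰⇒> {x} {y} x≰y with ≤.total x y
  ... | inj₁ x≤y = contradiction x≤y x≰y
  ... | inj₂ y≤x = y≤x , λ y≈x → x≰y (≤.reflexive (sym y≈x))

  <⇒≱ : ∀ {x y} → x < y → ¬ y ≤ x
  <⇒≱ (x≤y , x≉y) y≤x = x≉y (≤.antisym x≤y y≤x)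

  <-≤-trans : ∀ {x y z} → x < y → y ≤ z → x < z
  <-≤-trans x<y@(x≤y , _) y≤z = ≤.trans x≤y y≤z , λ x≈z → <⇒≱ x<y (≤.≤-respʳ-≈ (sym x≈z) y≤z)

  <-respʳ-≈ : ∀ {x y z} → y ≈ z → x < y → x < z
  <-respʳ-≈ y≈z x<y = <-≤-trans x<y (≤.reflexive y≈z)

  x*y≈0⇒y≈0 : ∀ {x y} → ¬ x ≈ 0# → x * y ≈ 0# → y ≈ 0#
  x*y≈0⇒y≈0 {x} {y} x≉0 xy≈0 = trans
    (modulo (- y) (⁻¹-inverse x x≉0)
      (solve 3 (λ x y k → y :- k :* (x :* y) := :- y :* (x :* k :- con (+ 1))) refl x y (x ⁻¹)))
    (trans (*-congˡ xy≈0) (zeroʳ _))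

  *-pos : ∀ {x y} → 0# < x → 0# < y → 0# < x * y
  *-pos (0≤x , 0≉x) (0≤y , 0≉y) = *-nonNeg 0≤x 0≤y ,
    λ 0≈xy → 0≉y (sym (x*y≈0⇒y≈0 (0≉x ∘ sym) (sym 0≈xy)))

  +-posˡ : ∀ {x y} → 0# < x → 0# ≤ y → 0# < x + y
  +-posˡ {x} {y} 0<x 0≤y = <-≤-trans 0<x
    (≤-by 0≤y (solve 2 (λ x y → x :+ y :- x := y) refl x y))

  x<y⇒0<y-x : ∀ {x y} → x < y → 0# < y - x
  x<y⇒0<y-x (x≤y , x≉y) = x≤y⇒0≤y-x x≤y , λ 0≈y-x → x≉y (sym (x-y≈0⇒x≈y (sym 0≈y-x)))

  0<y-x⇒x<y : ∀ {x y} → 0# < y - x → x < y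
  0<y-x⇒x<y (0≤y-x , 0≉y-x) = ≤-by 0≤y-x refl , λ x≈y → 0≉y-x (sym (x≈y⇒x-y≈0 (sym x≈y)))

  <-by : ∀ {x y d} → 0# < d → y - x ≈ d → x < y
  <-by 0<d eq = 0<y-x⇒x<y (<-respʳ-≈ (sym eq) 0<d)

  -- If the inverse k were at most 0, then x * (0 - k), which equals -1, would be nonnegative.
  ⁻¹-pos : ∀ {x} → 0# < x → 0# < x ⁻¹
  ⁻¹-pos {x} 0<x@(0≤x , 0≉x) = ≰⇒> λ k≤0 → <⇒≱ 0<1
    (≤-by (*-nonNeg 0≤x (x≤y⇒0≤y-x k≤0))
      (modulo 1# (⁻¹-inverse x (0≉x ∘ sym))
        (solve 2 (λ x k → (con (+ 0) :- con (+ 1)) :- x :* (con (+ 0) :- k)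
                          := con (+ 1) :* (x :* k :- con (+ 1))) refl x (x ⁻¹))))

  x²≤y²⇒x≤y : ∀ {x y} → 0# ≤ y → x * x ≤ y * y → x ≤ y
  x²≤y²⇒x≤y {x} {y} 0≤y x²≤y² with x ≤.≤? y
  ... | yes x≤y = x≤y
  ... | no  x≰y = contradiction x²≤y² (<⇒≱ (<-by (*-pos 0<x-y (+-posˡ 0<x-y (+-nonNeg 0≤y 0≤y)))
      (solve 2 (λ x y → x :* x :- y :* y := (x :- y) :* ((x :- y) :+ (y :+ y))) refl x y)))
    where
    0<x-y : 0# < x - y
    0<x-y = x<y⇒0<y-x (≰⇒> x≰y)

  -- Square roots from suprema

  √-upper : ∀ {a y} → y ∈ BelowSqrt a → y ≤ √ a
  √-upper {a} = proj₁ (proj₂ (supremum (BelowSqrt a) (0# , inj₁ ≤.refl) (BelowSqrt-bounded a))) _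

  √-least : ∀ {a b} → UpperBound (BelowSqrt a) b → √ a ≤ b
  √-least {a} = proj₂ (proj₂ (supremum (BelowSqrt a) (0# , inj₁ ≤.refl) (BelowSqrt-bounded a))) _

  √-nonNeg : ∀ a → 0# ≤ √ a
  √-nonNeg a = √-upper (inj₁ ≤.refl)

  √-mono : ∀ {a b} → a ≤ b → √ a ≤ √ b
  √-mono {a} {b} a≤b = √-least bound
    where
    bound : UpperBound (BelowSqrt a) (√ b)
    bound y (inj₁ y≤0)  = √-upper (inj₁ y≤0)
    bound y (inj₂ y²≤a) = √-upper (inj₂ (≤.trans y²≤a a≤b))

  √-cong : ∀ {a b} → a ≈ b → √ a ≈ √ b
  √-cong a≈b = ≤.antisym (√-mono (≤.reflexive a≈b)) (√-mono (≤.reflexive (sym a≈b)))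

  -- If s = √a had s² < a with defect d, then (s + η)² ≤ a for η = d / (d + 2s + 1), and s would not
  -- be an upper bound.
  a≤√a² : ∀ a → a ≤ √ a * √ a
  a≤√a² a with a ≤.≤? √ a * √ a
  ... | yes a≤s² = a≤s²
  ... | no  a≰s² = contradiction
      (√-upper (inj₂ (≤-by
        (*-nonNeg (*-nonNeg (proj₁ 0<d) (proj₁ 0<k)) (+-nonNeg (proj₁ 0<d) (*-nonNeg (proj₁ 0<k) (+-nonNeg (+-nonNeg 0≤s 0≤s) 0≤1))))
        (modulo (d + d * k) (sym k-inverse)
          (solve 3 (λ a s k → let d = a :- s :* s in
            (a :- (s :+ d :* k) :* (s :+ d :* k)) :- d :* k :* (d :+ k :* (s :+ s :+ con (+ 1)))
            := (d :+ d :* k) :* (con (+ 1) :- (d :+ (s :+ s :+ con (+ 1))) :* k)) refl a s k)))))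
      (<⇒≱ (<-by (*-pos 0<d 0<k) (solve 2 (λ s η → (s :+ η) :- s := η) refl s (d * k))))
    where
    s = √ a
    d = a - s * s
    0≤s = √-nonNeg a
    0<d : 0# < d
    0<d = x<y⇒0<y-x (≰⇒> a≰s²)
    0<m : 0# < d + (s + s + 1#)
    0<m = +-posˡ 0<d (+-nonNeg (+-nonNeg 0≤s 0≤s) 0≤1)
    k = (d + (s + s + 1#)) ⁻¹
    0<k : 0# < k
    0<k = ⁻¹-pos 0<m
    k-inverse : (d + (s + s + 1#)) * k ≈ 1#
    k-inverse = ⁻¹-inverse _ (proj₂ 0<m ∘ sym)

  -- If s = √a had s² > a, the Newton step (s² + a) / 2s would be a smaller upper bound: with d = s²
  -- - a it equals s - d / 2s, and its square is at least a.
  √a²≤a : ∀ {a} → 0# ≤ a → √ a * √ a ≤ a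
  √a²≤a {a} 0≤a with √ a * √ a ≤.≤? a
  ... | yes s²≤a = s²≤a
  ... | no  s²≰a = contradiction (√-least bound)
      (<⇒≱ (<-by (*-pos 0<d 0<k) (solve 2 (λ s η → s :- (s :- η) := η) refl s (d * k))))
    where
    s = √ a
    d = s * s - a
    0≤s = √-nonNeg a
    0<d : 0# < d
    0<d = x<y⇒0<y-x (≰⇒> s²≰a)
    0<s : 0# < s
    0<s = 0≤s , λ 0≈s → s²≰a (≤.≤-respˡ-≈ (trans (sym (zeroˡ s)) (*-congʳ 0≈s)) 0≤a)
    0<2s : 0# < s + s
    0<2s = +-posˡ 0<s 0≤s
    k = (s + s) ⁻¹
    0<k : 0# < k
    0<k = ⁻¹-pos 0<2s
    k-inverse : (s + s) * k ≈ 1#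
    k-inverse = ⁻¹-inverse _ (proj₂ 0<2s ∘ sym)
    0≤s-η : 0# ≤ s - d * k
    0≤s-η = ≤.≤-respʳ-≈
      (modulo s k-inverse
        (solve 3 (λ a s k → (s :* s :+ a) :* k :- (s :- (s :* s :- a) :* k)
                            := s :* ((s :+ s) :* k :- con (+ 1))) refl a s k))
      (*-nonNeg (+-nonNeg (0≤x² s) 0≤a) (proj₁ 0<k))
    bound : UpperBound (BelowSqrt a) (s - d * k)
    bound y (inj₁ y≤0)  = ≤.trans y≤0 0≤s-η
    bound y (inj₂ y²≤a) = x²≤y²⇒x≤y 0≤s-η (≤.trans y²≤a (≤-by (0≤x² (d * k))
      (modulo (- d) k-inverse
        (solve 3 (λ a s k → let d = s :* s :- a in
            ((s :- d :* k) :* (s :- d :* k) :- a) :- d :* k :* (d :* k)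
            := :- d :* ((s :+ s) :* k :- con (+ 1))) refl a s k))))

  √-cancel-≤ : ∀ {a b} → 0# ≤ b → √ a ≤ √ b → a ≤ b
  √-cancel-≤ {a} {b} 0≤b √a≤√b = ≤.trans (a≤√a² a)
    (≤.trans (*-monoʳ-≤ _ (√-nonNeg a) √a≤√b)
    (≤.trans (≤.≤-respˡ-≈ (*-comm _ _) (*-monoʳ-≤ _ (√-nonNeg b) √a≤√b)) (√a²≤a 0≤b)))

  √a<ε : ∀ {a ε} → 0# < ε → 0# ≤ a → a < ε * ε → √ a < ε
  √a<ε {a} {ε} 0<ε 0≤a a<ε² = ≰⇒> λ ε≤√a → <⇒≱ a<ε²
    (≤.trans (*-monoʳ-≤ _ (proj₁ 0<ε) ε≤√a)
    (≤.trans (≤.≤-respˡ-≈ (*-comm _ _) (*-monoʳ-≤ _ (√-nonNeg a) ε≤√a)) (√a²≤a 0≤a)))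

-- Finite sums, inner products and coordinate permutations

module Euclidean (ℝ : CompleteOrderedField) where

  open Ordered ℝ
  open Geometry ℝ
  open SemiringSum semiring public using (sum-cong-≋; ∑-distrib-+; ∑-comm; sum-permute; sum-remove; *-distribˡ-sum; *-distribʳ-sum; sum-replicate-zero; sum-replicate)
  open import Relation.Binary.Reasoning.Setoid setoid

  private
    variable
      N n m : ℕ

  sum-neg : (f : Vector R n) → sum (λ i → - f i) ≈ - sum f
  sum-neg {zero}  f = sym -0#≈0#
  sum-neg {suc n} f = trans (+-congˡ (sum-neg (f ∘ suc))) (-‿+-comm _ _)

  sum-- : (f g : Vector R n) → sum (λ i → f i - g i) ≈ sum f - sum g
  sum-- f g = trans (∑-distrib-+ f (λ i → - g i)) (+-congˡ (sum-neg g))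

  sum-zero : {f : Vector R n} → (∀ i → f i ≈ 0#) → sum f ≈ 0#
  sum-zero {n} f≈0 = trans (sum-cong-≋ f≈0) (sum-replicate-zero n)

  sum-nonNeg : {f : Vector R n} → (∀ i → 0# ≤ f i) → 0# ≤ sum f
  sum-nonNeg {zero}  0≤f = ≤.refl
  sum-nonNeg {suc n} 0≤f = +-nonNeg (0≤f zero) (sum-nonNeg (0≤f ∘ suc))

  sum-mono-≤ : {f g : Vector R n} → (∀ i → f i ≤ g i) → sum f ≤ sum g
  sum-mono-≤ {zero}  f≤g = ≤.refl
  sum-mono-≤ {suc n} f≤g = +-mono-≤ (f≤g zero) (sum-mono-≤ (f≤g ∘ suc))

  sum-const : ∀ n s → sum {n} (λ _ → s) ≈ (n ·ℕ 1#) * s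
  sum-const n s = begin
    sum {n} (λ _ → s)      ≈⟨ sum-cong-≋ {n} (λ _ → sym (*-identityˡ s)) ⟩
    sum {n} (λ _ → 1# * s) ≈⟨ *-distribʳ-sum {n} s (λ _ → 1#) ⟨
    sum {n} (λ _ → 1#) * s ≈⟨ *-congʳ (sum-replicate n) ⟩
    (n ·ℕ 1#) * s          ∎

  δ-refl : (i : Fin n) → δ i i ≡ 1#
  δ-refl i = ≡.cong (if_then 1# else 0#) (dec-true (i ≟ i) ≡.refl)

  δ-≢ : {i j : Fin n} → i ≢ j → δ i j ≡ 0#
  δ-≢ {i = i} {j} i≢j = ≡.cong (if_then 1# else 0#) (dec-false (i ≟ j) i≢j)

  δ-comm : (i j : Fin n) → δ i j ≡ δ j i
  δ-comm i j with i ≟ j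
  ... | yes ≡.refl = ≡.sym (δ-refl i)
  ... | no  i≢j    = ≡.sym (δ-≢ (i≢j ∘ ≡.sym))

  δ-injective : {i j : Fin n} → δ i j ≈ 1# → i ≡ j
  δ-injective {i = i} {j} eq with i ≟ j
  ... | yes i≡j = i≡j
  ... | no  i≢j = contradiction eq 0≉1

  δ-permute : (π : Permutation′ n) (i j : Fin n) → δ i (π ⟨$⟩ʳ j) ≡ δ (π ⟨$⟩ˡ i) j
  δ-permute π i j with i ≟ (π ⟨$⟩ʳ j)
  ... | yes ≡.refl = ≡.sym (≡.trans (≡.cong (λ k → δ k j) (Perm.inverseˡ π)) (δ-refl j))
  ... | no  i≢πj   = ≡.sym (δ-≢ {i = π ⟨$⟩ˡ i} {j} λ { ≡.refl → i≢πj (≡.sym (Perm.inverseʳ π)) })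

  sum-δ : (i : Fin n) (f : Vector R n) → sum (λ j → δ i j * f j) ≈ f i
  sum-δ zero    f = trans (+-cong (*-identityˡ _) (sum-zero λ j → zeroˡ (f (suc j)))) (+-identityʳ _)
  sum-δ (suc i) f = trans (+-cong (zeroˡ _) (sum-δ i (f ∘ suc))) (+-identityˡ _)

  ∙-comm : (x y : Point N) → x ∙ y ≈ y ∙ x
  ∙-comm x y = sum-cong-≋ λ i → *-comm (x i) (y i)

  ∙-cong : {x x′ y y′ : Point N} → x ≋ x′ → y ≋ y′ → x ∙ y ≈ x′ ∙ y′
  ∙-cong x≋x′ y≋y′ = sum-cong-≋ λ i → *-cong (x≋x′ i) (y≋y′ i)

  ∙-distribˡ-+ : (x y z : Point N) → x ∙ (y +ᵥ z) ≈ x ∙ y + x ∙ z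
  ∙-distribˡ-+ x y z = trans (sum-cong-≋ λ i → distribˡ (x i) (y i) (z i)) (∑-distrib-+ (λ i → x i * y i) (λ i → x i * z i))

  ∙-distribˡ-- : (x y z : Point N) → x ∙ (y -ᵥ z) ≈ x ∙ y - x ∙ z
  ∙-distribˡ-- x y z = trans
    (sum-cong-≋ λ i → solve 3 (λ x y z → x :* (y :- z) := x :* y :- x :* z) refl (x i) (y i) (z i))
    (sum-- (λ i → x i * y i) (λ i → x i * z i))

  ∙-*ˡ : (c : R) (x y : Point N) → (λ i → c * x i) ∙ y ≈ c * (x ∙ y)
  ∙-*ˡ c x y = trans (sum-cong-≋ λ i → *-assoc c (x i) (y i)) (sym (*-distribˡ-sum c (λ i → x i * y i)))

  ∙-combination : (u : Point N) (t : Vector R m) (a : Vector (Point N) m) →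
                  u ∙ combination t a ≈ sum (λ i → t i * (u ∙ a i))
  ∙-combination u t a = begin
    sum (λ l → u l * sum (λ i → t i * a i l))
      ≈⟨ sum-cong-≋ (λ l → *-distribˡ-sum (u l) (λ i → t i * a i l)) ⟩
    sum (λ l → sum (λ i → u l * (t i * a i l)))
      ≈⟨ ∑-comm (λ l i → u l * (t i * a i l)) ⟩
    sum (λ i → sum (λ l → u l * (t i * a i l)))
      ≈⟨ sum-cong-≋ (λ i → sum-cong-≋ λ l → solve 3 (λ u t a → u :* (t :* a) := t :* (u :* a)) refl (u l) (t i) (a i l)) ⟩
    sum (λ i → sum (λ l → t i * (u l * a i l)))
      ≈⟨ sum-cong-≋ (λ i → sym (*-distribˡ-sum (t i) (λ l → u l * a i l))) ⟩
    sum (λ i → t i * (u ∙ a i)) ∎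

  combination-cong : {s t : Vector R m} {a b : Vector (Point N) m} →
                     (∀ i → s i ≈ t i) → (∀ i → a i ≋ b i) → combination s a ≋ combination t b
  combination-cong s≈t a≋b l = sum-cong-≋ λ i → *-cong (s≈t i) (a≋b i l)

  combination-permute : (π : Permutation′ m) (t : Vector R m) (a : Vector (Point N) m) →
                        combination t a ≋ combination (t ∘ (π ⟨$⟩ʳ_)) (a ∘ (π ⟨$⟩ʳ_))
  combination-permute π t a l = sum-permute (λ i → t i * a i l) π

  x∙x-nonNeg : (x : Point N) → 0# ≤ x ∙ x
  x∙x-nonNeg x = sum-nonNeg λ i → 0≤x² (x i)

  preserves-∙⇒isometry : {f : Point N → Point N} →
    (∀ x y → (f x -ᵥ f y) ∙ (f x -ᵥ f y) ≈ (x -ᵥ y) ∙ (x -ᵥ y)) → IsIsometry f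
  preserves-∙⇒isometry eq x y = √-cong (eq x y)

  ≅-resp-≐ : {P P′ Q Q′ : PointSet N} → P ≐ P′ → Q ≐ Q′ → P ≅ Q → P′ ≅ Q′
  ≅-resp-≐ (P⊆P′ , P′⊆P) (Q⊆Q′ , Q′⊆Q) (f , f-iso , fP⊆Q , Q⊆fP) = f , f-iso ,
    (λ { (x , x∈P′ , eq) → Q⊆Q′ (fP⊆Q (x , P′⊆P x∈P′ , eq)) }) ,
    (λ y∈Q′ → let (x , x∈P , eq) = Q⊆fP (Q′⊆Q y∈Q′) in x , P⊆P′ x∈P , eq)

  -- The inverse appears so that `act π` sends e i to e (π i), which is multiplication by
  -- `permutationMatrix π`.
  act : Permutation′ N → Point N → Point N
  act π x i = x (π ⟨$⟩ˡ i)

  act-isometry : (π : Permutation′ N) → IsIsometry (act π)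
  act-isometry π = preserves-∙⇒isometry λ x y →
    sym (sum-permute (λ i → (x i - y i) * (x i - y i)) (Perm.flip π))

  act-images-congruent : (π ρ : Permutation′ N) (P : PointSet N) → image (act π) P ≅ image (act ρ) P
  act-images-congruent π ρ P = act σ , act-isometry σ ,
    (λ { (y , (x , x∈P , y≋πx) , z≋σy) → x , x∈P ,
         λ i → trans (z≋σy i) (trans (y≋πx _) (reflexive (≡.cong x (Perm.inverseˡ π)))) }) ,
    (λ { (x , x∈P , y≋ρx) → act π x , (x , x∈P , λ _ → refl) ,
         λ i → trans (y≋ρx i) (reflexive (≡.cong x (≡.sym (Perm.inverseˡ π)))) })
    where σ = Perm.flip π ∘ₚ ρ

  permutationMatrix-act : {M : Matrix N} (π : Permutation′ N) → M ≋ₘ permutationMatrix π →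
                          ∀ x → M *ᵥ x ≋ act π x
  permutationMatrix-act π M≋π x i = trans
    (sum-cong-≋ λ j → *-congʳ (trans (M≋π i j) (reflexive (δ-permute π i j))))
    (sum-δ (π ⟨$⟩ˡ i) x)

  *ₛ≐act : {M : Matrix N} (π : Permutation′ N) → M ≋ₘ permutationMatrix π →
           (P : PointSet N) → M *ₛ P ≐ image (act π) P
  *ₛ≐act π M≋π P =
    (λ { (x , x∈P , eq) → x , x∈P , λ i → trans (eq i) (permutationMatrix-act π M≋π x i) }) ,
    (λ { (x , x∈P , eq) → x , x∈P , λ i → trans (eq i) (sym (permutationMatrix-act π M≋π x i)) })

  -- Relative interiors

  -- The extended point is the affine combination of x and q with weights 1 + η and -η, so it lies
  -- in the affine hull; a small η keeps it inside the ball around x.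
  relativeInterior-extend : {P : PointSet N} {x q : Point N} → x ∈ relativeInterior P → q ∈ P →
    ∃ λ η → 0# < η × (λ i → x i + η * (x i - q i)) ∈ P
  relativeInterior-extend {P = P} {x} {q} (x∈P , ε , 0<ε , ball) q∈P =
    η , 0<η , ball y (2 , p , c , p∈P , sum-c , y-combination) y-near
    where
    D = (x -ᵥ q) ∙ (x -ᵥ q)
    0≤D = x∙x-nonNeg (x -ᵥ q)
    0<1+D : 0# < 1# + D
    0<1+D = +-posˡ 0<1 0≤D
    k = (1# + D) ⁻¹
    0<k : 0# < k
    0<k = ⁻¹-pos 0<1+D
    k-inverse : (1# + D) * k ≈ 1#
    k-inverse = ⁻¹-inverse _ (proj₂ 0<1+D ∘ sym)
    -- With D the squared distance from x to q, η = ε / (1 + D) gives η² D < ε²; this also covers q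
    -- = x and takes no root.
    η = ε * k
    0<η : 0# < η
    0<η = *-pos 0<ε 0<k
    y = λ i → x i + η * (x i - q i)
    p : Vector (Point _) 2
    p zero    = x
    p (suc _) = q
    c : Vector R 2
    c zero    = 1# + η
    c (suc _) = - η
    p∈P : ∀ i → p i ∈ P
    p∈P zero    = x∈P
    p∈P (suc _) = q∈P
    sum-c : sum c ≈ 1#
    sum-c = solve 1 (λ η → (con (+ 1) :+ η) :+ (:- η :+ con (+ 0)) := con (+ 1)) refl η
    y-combination : y ≋ combination c p
    y-combination i = solve 3 (λ x q η → x :+ η :* (x :- q) :=
      (con (+ 1) :+ η) :* x :+ (:- η :* q :+ con (+ 0))) refl (x i) (q i) η
    norm² : (y -ᵥ x) ∙ (y -ᵥ x) ≈ η * η * D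
    norm² = trans (sum-cong-≋ λ i →
        solve 3 (λ x q η → (x :+ η :* (x :- q) :- x) :* (x :+ η :* (x :- q) :- x)
                           := (η :* η) :* ((x :- q) :* (x :- q))) refl (x i) (q i) η)
      (sym (*-distribˡ-sum (η * η) (λ i → (x i - q i) * (x i - q i))))
    y-near : ‖ y -ᵥ x ‖ < ε
    y-near = √a<ε 0<ε (x∙x-nonNeg (y -ᵥ x))
      (<-by (*-pos (*-pos 0<η 0<η) (+-posˡ 0<1 (+-nonNeg 0≤D (0≤x² D))))
        (trans (+-congˡ (-‿cong norm²))
        (modulo (- (ε * ε) * (1# + (1# + D) * k)) k-inverse
          (solve 3 (λ ε k D → (ε :* ε :- (ε :* k) :* (ε :* k) :* D)
              :- (ε :* k) :* (ε :* k) :* (con (+ 1) :+ (D :+ D :* D))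
            := :- (ε :* ε) :* (con (+ 1) :+ (con (+ 1) :+ D) :* k) :* ((con (+ 1) :+ D) :* k :- con (+ 1)))
          refl ε k D))))

  -- If the inequality were not strict at x, the point slightly past x on the line from q would
  -- violate it.
  relativeInterior-strict : {P : PointSet N} {x q : Point N} (i j : Fin N) →
    (∀ {y} → y ∈ P → y i ≤ y j) → q ∈ P → q i < q j → x ∈ relativeInterior P → x i < x j
  relativeInterior-strict {x = x} {q} i j P⊆ q∈P qi<qj x∈P =
    let (η , 0<η , y∈P) = relativeInterior-extend x∈P q∈P in
    ≰⇒> λ xj≤xi → <⇒≱ (<-by (+-posˡ (*-pos 0<η (x<y⇒0<y-x qi<qj))
                              (*-nonNeg (+-nonNeg 0≤1 (proj₁ 0<η)) (x≤y⇒0≤y-x xj≤xi)))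
      (solve 5 (λ xi xj qi qj η → (xi :+ η :* (xi :- qi)) :- (xj :+ η :* (xj :- qj))
        := η :* (qj :- qi) :+ (con (+ 1) :+ η) :* (xi :- xj)) refl (x i) (x j) (q i) (q j) η))
      (P⊆ y∈P)

-- Parallelepipeds and hyper-rhombi

module HyperRhombic (ℝ : CompleteOrderedField) where

  open Ordered ℝ
  open Geometry ℝ
  open Euclidean ℝ
  open import Relation.Binary.Reasoning.Setoid setoid

  private
    variable
      N n m d : ℕ

  InUnitInterval : R → Set
  InUnitInterval t = 0# ≤ t × t ≤ 1#

  0∈[0,1] : InUnitInterval 0#
  0∈[0,1] = ≤.refl , 0≤1

  1∈[0,1] : InUnitInterval 1#
  1∈[0,1] = 0≤1 , ≤.refl

  [0,1]-resp-≈ : {x y : R} → x ≈ y → InUnitInterval x → InUnitInterval y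
  [0,1]-resp-≈ x≈y (0≤x , x≤1) = ≤.≤-respʳ-≈ x≈y 0≤x , ≤.≤-respˡ-≈ x≈y x≤1

  δ∈[0,1] : (i j : Fin n) → InUnitInterval (δ i j)
  δ∈[0,1] i j with does (i ≟ j)
  ... | true  = 1∈[0,1]
  ... | false = 0∈[0,1]

  δ-punchIn : (i : Fin (suc n)) (j k : Fin n) → δ (punchIn i j) (punchIn i k) ≡ δ j k
  δ-punchIn i j k with j ≟ k
  ... | yes ≡.refl = δ-refl (punchIn i j)
  ... | no  j≢k    = δ-≢ (j≢k ∘ punchIn-injective i j k)

  all-insertAt : {Q : R → Set} {s : R} (t : Vector R n) (i : Fin (suc n)) →
                 Q s → (∀ j → Q (t j)) → ∀ j → Q (insertAt t i s j)
  all-insertAt         t zero    Qs Qt zero    = Qs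
  all-insertAt         t zero    Qs Qt (suc j) = Qt j
  all-insertAt {suc n} t (suc i) Qs Qt zero    = Qt zero
  all-insertAt {suc n} {Q} t (suc i) Qs Qt (suc j) = all-insertAt {Q = Q} (t ∘ suc) i Qs (Qt ∘ suc) j

  sum-insertAt : (f : R → Fin (suc n) → R) (t : Vector R n) (i : Fin (suc n)) (s : R) →
    sum (λ j → f (insertAt t i s j) j) ≈ f s i + sum (λ j → f (t j) (punchIn i j))
  sum-insertAt f t i s = trans (sum-remove {i = i} (λ j → f (insertAt t i s j) j))
    (+-cong (reflexive (≡.cong (λ v → f v i) (insertAt-lookup t i s)))
            (sum-cong-≋ λ j → reflexive (≡.cong (λ v → f v (punchIn i j)) (insertAt-punchIn t i s j))))

  -- Homogeneous systems with one more unknown than equations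

  find-pivot : (b : Vector R (suc d)) →
    ∃ λ k₀ → ∃ λ (g : Vector R d) → ∀ k → b (punchIn k₀ k) ≈ b k₀ * g k
  find-pivot b with any? (λ k → ¬? (b k ≤.≟ 0#))
  ... | yes (k₀ , b≉0) = k₀ , (λ k → b k₀ ⁻¹ * b (punchIn k₀ k)) , λ k → sym (begin
          b k₀ * (b k₀ ⁻¹ * b (punchIn k₀ k))  ≈⟨ *-assoc (b k₀) (b k₀ ⁻¹) (b (punchIn k₀ k)) ⟨
          b k₀ * b k₀ ⁻¹ * b (punchIn k₀ k)    ≈⟨ *-congʳ (⁻¹-inverse (b k₀) b≉0) ⟩
          1# * b (punchIn k₀ k)                ≈⟨ *-identityˡ (b (punchIn k₀ k)) ⟩
          b (punchIn k₀ k)                     ∎)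
  -- A zero row imposes no condition: any position serves as pivot, with multipliers 0.
  ... | no  all≈0      = zero , (λ _ → 0#) , λ k →
          trans (decidable-stable (b (suc k) ≤.≟ 0#) λ b≉0 → all≈0 (suc k , b≉0)) (sym (zeroʳ (b zero)))

  -- Gaussian elimination: the pivot's unknown k₀ is eliminated from all equations.
  underdetermined : ∀ d (B : Fin d → Fin (suc d) → R) → ∃ λ (c : Vector R (suc d)) →
    (∃ λ k → ¬ c k ≈ 0#) × (∀ l → sum (λ k → B l k * c k) ≈ 0#)
  underdetermined zero    B = (λ _ → 1#) , (zero , 0≉1 ∘ sym) , λ ()
  underdetermined (suc d) B = c , (punchIn k₀ (proj₁ nonzero) , c≉0) , solves
    where
    pivot = find-pivot (B zero)
    k₀ = proj₁ pivot
    g  = proj₁ (proj₂ pivot)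
    ih = underdetermined d (λ l k → B (suc l) (punchIn k₀ k) - B (suc l) k₀ * g k)
    c′ = proj₁ ih
    nonzero = proj₁ (proj₂ ih)
    c = insertAt c′ k₀ (- sum (λ k → g k * c′ k))
    c≉0 : ¬ c (punchIn k₀ (proj₁ nonzero)) ≈ 0#
    c≉0 = proj₂ nonzero ∘ trans (reflexive (≡.sym (insertAt-punchIn c′ k₀ (- sum (λ k → g k * c′ k)) (proj₁ nonzero))))
    eliminate : (b : Fin (suc (suc d)) → R) →
                sum (λ k → b k * c k) ≈ sum (λ k → (b (punchIn k₀ k) - b k₀ * g k) * c′ k)
    eliminate b = begin
      sum (λ k → b k * c k)
        ≈⟨ sum-insertAt (λ v k → b k * v) c′ k₀ (- sum (λ k → g k * c′ k)) ⟩
      b k₀ * (- sum (λ k → g k * c′ k)) + sum (λ k → b (punchIn k₀ k) * c′ k)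
        ≈⟨ solve 3 (λ b s t → b :* (:- s) :+ t := t :- b :* s) refl (b k₀) (sum (λ k → g k * c′ k)) (sum (λ k → b (punchIn k₀ k) * c′ k)) ⟩
      sum (λ k → b (punchIn k₀ k) * c′ k) - b k₀ * sum (λ k → g k * c′ k)
        ≈⟨ +-congˡ (-‿cong (*-distribˡ-sum (b k₀) (λ k → g k * c′ k))) ⟩
      sum (λ k → b (punchIn k₀ k) * c′ k) - sum (λ k → b k₀ * (g k * c′ k))
        ≈⟨ sum-- (λ k → b (punchIn k₀ k) * c′ k) (λ k → b k₀ * (g k * c′ k)) ⟨
      sum (λ k → b (punchIn k₀ k) * c′ k - b k₀ * (g k * c′ k))
        ≈⟨ sum-cong-≋ (λ k → solve 4 (λ b b₀ g c → b :* c :- b₀ :* (g :* c) := (b :- b₀ :* g) :* c) refl (b (punchIn k₀ k)) (b k₀) (g k) (c′ k)) ⟩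
      sum (λ k → (b (punchIn k₀ k) - b k₀ * g k) * c′ k) ∎
    solves : ∀ l → sum (λ k → B l k * c k) ≈ 0#
    solves zero    = trans (eliminate (B zero))
      (sum-zero λ k → trans (*-congʳ (x≈y⇒x-y≈0 (proj₂ (proj₂ pivot) k))) (zeroˡ (c′ k)))
    solves (suc l) = trans (eliminate (B (suc l))) (proj₂ (proj₂ ih) l)

  -- Facets of a parallelepiped

  parallelepiped-remove : (p : Point N) (a : Vector (Point N) (suc d)) (t : Vector R (suc d)) (i : Fin (suc d)) →
    p +ᵥ combination t a ≋ (λ l → p l + t i * a i l) +ᵥ combination (removeAt t i) (removeAt a i)
  parallelepiped-remove p a t i l =
    trans (+-congˡ (sum-remove {i = i} (λ j → t j * a j l))) (sym (+-assoc _ _ _))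

  parallelepiped-insert : (p : Point N) (a : Vector (Point N) (suc d)) (t : Vector R d) (i : Fin (suc d)) (s : R) →
    p +ᵥ combination (insertAt t i s) a ≋ (λ l → p l + s * a i l) +ᵥ combination t (removeAt a i)
  parallelepiped-insert p a t i s l =
    trans (+-congˡ (sum-insertAt (λ v j → v * a j l) t i s)) (sym (+-assoc _ _ _))

  removeAt-independent : (a : Vector (Point N) (suc d)) (i : Fin (suc d)) →
                         LinearlyIndependent a → LinearlyIndependent (removeAt a i)
  removeAt-independent a i independent c eq j = trans
    (reflexive (≡.sym (insertAt-punchIn c i 0# j)))
    (independent (insertAt c i 0#)
      (λ l → trans (sum-insertAt (λ v j → v * a j l) c i 0#)
             (trans (+-cong (zeroˡ _) (eq l)) (+-identityˡ _)))
      (punchIn i j))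

  combination-combination : (c : Vector R m) (T : Fin m → Vector R d) (p : Point N) (a : Vector (Point N) d) →
    combination c (λ k → p +ᵥ combination (T k) a) ≋
    λ l → sum c * p l + sum (λ j → sum (λ k → T k j * c k) * a j l)
  combination-combination c T p a l = begin
    sum (λ k → c k * (p l + sum (λ j → T k j * a j l)))
      ≈⟨ sum-cong-≋ (λ k → trans (distribˡ (c k) (p l) (combination (T k) a l))
                                 (+-congˡ (*-distribˡ-sum (c k) (λ j → T k j * a j l)))) ⟩
    sum (λ k → c k * p l + sum (λ j → c k * (T k j * a j l)))
      ≈⟨ ∑-distrib-+ (λ k → c k * p l) (λ k → sum (λ j → c k * (T k j * a j l))) ⟩
    sum (λ k → c k * p l) + sum (λ k → sum (λ j → c k * (T k j * a j l)))
      ≈⟨ +-cong (sym (*-distribʳ-sum (p l) c)) (∑-comm (λ k j → c k * (T k j * a j l))) ⟩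
    sum c * p l + sum (λ j → sum (λ k → c k * (T k j * a j l)))
      ≈⟨ +-congˡ (sum-cong-≋ λ j → sum-cong-≋ λ k →
           solve 3 (λ c t a → c :* (t :* a) := (t :* c) :* a) refl (c k) (T k j) (a j l)) ⟩
    sum c * p l + sum (λ j → sum (λ k → T k j * c k * a j l))
      ≈⟨ +-congˡ (sum-cong-≋ λ j → sym (*-distribʳ-sum (a j l) (λ k → T k j * c k))) ⟩
    sum c * p l + sum (λ j → sum (λ k → T k j * c k) * a j l) ∎

  -- Two fixed coordinates leave only d - 1 free ones, too few for d + 1
  -- affinely independent points.
  two-fixed-coordinates : {p : Point N} {a : Vector (Point N) (suc d)} {pts : Vector (Point N) (suc d)}
    (T : Fin (suc d) → Vector R (suc d)) → (∀ k → pts k ≋ p +ᵥ combination (T k) a) →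
    ∀ i l₀ {s s′} → (∀ k → T k i ≈ s) → (∀ k → T k (punchIn i l₀) ≈ s′) → ¬ AffinelyIndependent pts
  two-fixed-coordinates {d = d} {p} {a} {pts} T pts≋ i l₀ {s} {s′} Ti≈s Tj≈s′ independent =
    let (k , ck≉0) = nonzero in ck≉0 (independent c sum-c≈0 combination≈0 k)
    where
    B : Fin d → Fin (suc d) → R
    -- The row of the second fixed coordinate is replaced by ones, which forces sum c = 0. Each
    -- fixed coordinate then contributes its constant times sum c, that is 0, so these d equations
    -- account for all d + 1 coordinates and for the affine condition.
    B l k = if does (l ≟ l₀) then 1# else T k (punchIn i l)
    c : Vector R (suc d)
    c = proj₁ (underdetermined d B)
    nonzero : ∃ λ k → ¬ c k ≈ 0#
    nonzero = proj₁ (proj₂ (underdetermined d B))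
    B∙c≈0 : ∀ l → sum (λ k → B l k * c k) ≈ 0#
    B∙c≈0 = proj₂ (proj₂ (underdetermined d B))
    sum-c≈0 : sum c ≈ 0#
    sum-c≈0 = trans (sum-cong-≋ λ k → sym (trans (*-congʳ (reflexive (row-l₀ k))) (*-identityˡ (c k)))) (B∙c≈0 l₀)
      where
      row-l₀ : ∀ k → B l₀ k ≡ 1#
      row-l₀ k = ≡.cong (if_then 1# else T k (punchIn i l₀)) (dec-true (l₀ ≟ l₀) ≡.refl)
    fixed-sum : ∀ j {s} → (∀ k → T k j ≈ s) → sum (λ k → T k j * c k) ≈ 0#
    fixed-sum j {s} Tj≈s = trans (sum-cong-≋ λ k → *-congʳ {c k} (Tj≈s k))
      (trans (sym (*-distribˡ-sum s c)) (trans (*-congˡ sum-c≈0) (zeroʳ s)))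
    free-sum : ∀ l → sum (λ k → T k (punchIn i l) * c k) ≈ 0#
    free-sum l with l ≟ l₀ | B∙c≈0 l
    ... | yes ≡.refl | _  = fixed-sum (punchIn i l) Tj≈s′
    ... | no  _      | eq = eq
    sum-T≈0 : ∀ j → sum (λ k → T k j * c k) ≈ 0#
    sum-T≈0 j with i ≟ j
    ... | yes ≡.refl = fixed-sum i Ti≈s
    ... | no  i≢j    = ≡.subst (λ j → sum (λ k → T k j * c k) ≈ 0#) (punchIn-punchOut i≢j) (free-sum (punchOut i≢j))
    combination≈0 : combination c pts ≋ 0ᵥ
    combination≈0 m = begin
      combination c pts m
        ≈⟨ combination-cong {s = c} (λ _ → refl) pts≋ m ⟩
      combination c (λ k → p +ᵥ combination (T k) a) m
        ≈⟨ combination-combination c T p a m ⟩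
      sum c * p m + sum (λ l → sum (λ k → T k l * c k) * a l m)
        ≈⟨ +-cong (trans (*-congʳ sum-c≈0) (zeroˡ (p m)))
                  (sum-zero λ l → trans (*-congʳ (sum-T≈0 l)) (zeroˡ (a l m))) ⟩
      0# + 0#
        ≈⟨ +-identityˡ 0# ⟩
      0# ∎

  -- Where the slope `w i` of the functional is nonzero, maximality pins the coefficient t i to an
  -- endpoint of [0, 1]. If all slopes vanish, F contains p and every p + a i, which are d + 2
  -- independent points; if two do not, the d + 1 independent points of F cannot exist. So exactly
  -- one generator is frozen.
  facet : (p : Point N) (a : Vector (Point N) (suc d)) → LinearlyIndependent a →
    {P F : PointSet N} → P ≐ parallelepiped p a → IsFaceOfDim d F P →
    ∃ λ (i : Fin (suc d)) → ∃ λ (q : Point N) → F ≐ parallelepiped q (removeAt a i)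
  facet {N = N} {d = d} p a independent {P} {F} (P⊆ , P⊇)
        ((u , c , u≤c , F⊆ , F⊇) , (pts , pts∈F , pts-independent) , no-more) = face
    where
    w : Fin (suc d) → R
    w i = u ∙ a i

    u∙point : ∀ {x} (t : Vector R (suc d)) → x ≋ p +ᵥ combination t a → u ∙ x ≈ u ∙ p + sum (λ i → t i * w i)
    u∙point {x} t eq = begin
      u ∙ x                             ≈⟨ ∙-cong {x = u} (λ _ → refl) eq ⟩
      u ∙ (p +ᵥ combination t a)        ≈⟨ ∙-distribˡ-+ u p (combination t a) ⟩
      u ∙ p + u ∙ combination t a       ≈⟨ +-congˡ (∙-combination u t a) ⟩
      u ∙ p + sum (λ i → t i * w i)     ∎

    F-coordinates : ∀ {x} → x ∈ F → ∃ λ (t : Vector R (suc d)) → (∀ i → InUnitInterval (t i)) ×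
                    x ≋ p +ᵥ combination t a × u ∙ p + sum (λ i → t i * w i) ≈ c
    F-coordinates x∈F = let (x∈P , u∙x≈c) = F⊆ x∈F; (t , bounds , eq) = P⊆ x∈P in
      t , bounds , eq , trans (sym (u∙point t eq)) u∙x≈c

    F-from : ∀ {x} (t : Vector R (suc d)) → (∀ i → InUnitInterval (t i)) → x ≋ p +ᵥ combination t a →
             u ∙ p + sum (λ i → t i * w i) ≈ c → x ∈ F
    F-from t bounds eq u≈c = F⊇ (P⊇ (t , bounds , eq) , trans (u∙point t eq) u≈c)

    T : Fin (suc d) → Fin (suc d) → R
    T k = proj₁ (F-coordinates (pts∈F k))
    T-bounds : ∀ k i → InUnitInterval (T k i)
    T-bounds k = proj₁ (proj₂ (F-coordinates (pts∈F k)))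
    pts≋ : ∀ k → pts k ≋ p +ᵥ combination (T k) a
    pts≋ k = proj₁ (proj₂ (proj₂ (F-coordinates (pts∈F k))))
    T-maximal : ∀ k → u ∙ p + sum (λ i → T k i * w i) ≈ c
    T-maximal k = proj₂ (proj₂ (proj₂ (F-coordinates (pts∈F k))))

    not-constant : ¬ (∀ i → w i ≈ 0#)
    not-constant w≈0 = no-more q q∈F q-independent
      where
      u≈c : ∀ (t : Vector R (suc d)) → u ∙ p + sum (λ i → t i * w i) ≈ c
      u≈c t = trans (+-congˡ (trans (vanishes t) (sym (vanishes (T zero)))))
                    (T-maximal zero)
        where
        vanishes : ∀ (t : Vector R (suc d)) → sum (λ i → t i * w i) ≈ 0#
        vanishes t = sum-zero λ i → trans (*-congˡ (w≈0 i)) (zeroʳ (t i))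
      q : Vector (Point N) (suc (suc d))
      q zero    = p
      q (suc i) = p +ᵥ a i
      q∈F : ∀ i → q i ∈ F
      q∈F zero    = F-from (λ _ → 0#) (λ _ → 0∈[0,1])
        (λ l → sym (trans (+-congˡ (sum-zero λ i → zeroˡ (a i l))) (+-identityʳ (p l)))) (u≈c (λ _ → 0#))
      q∈F (suc i) = F-from (δ i) (δ∈[0,1] i) (λ l → +-congˡ (sym (sum-δ i (λ j → a j l)))) (u≈c (δ i))
      q-independent : AffinelyIndependent q
      q-independent c sum-c≈0 combination≈0 = λ where
          zero    → trans (sym (trans (+-congˡ (sum-zero tail≈0)) (+-identityʳ _))) sum-c≈0
          (suc i) → tail≈0 i
        where
        tail≈0 : ∀ i → c (suc i) ≈ 0#
        tail≈0 = independent (c ∘ suc) λ l → begin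
          sum (λ i → c (suc i) * a i l)
            ≈⟨ trans (+-congʳ (zeroˡ (p l))) (+-identityˡ _) ⟨
          0# * p l + sum (λ i → c (suc i) * a i l)
            ≈⟨ +-congʳ (*-congʳ sum-c≈0) ⟨
          (c zero + sum (c ∘ suc)) * p l + sum (λ i → c (suc i) * a i l)
            ≈⟨ solve 4 (λ c s p t → (c :+ s) :* p :+ t := c :* p :+ (s :* p :+ t)) refl
                (c zero) (sum (c ∘ suc)) (p l) (sum (λ i → c (suc i) * a i l)) ⟩
          c zero * p l + (sum (c ∘ suc) * p l + sum (λ i → c (suc i) * a i l))
            ≈⟨ +-congˡ (+-congʳ (*-distribʳ-sum (p l) (c ∘ suc))) ⟩
          c zero * p l + (sum (λ i → c (suc i) * p l) + sum (λ i → c (suc i) * a i l))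
            ≈⟨ +-congˡ (∑-distrib-+ (λ i → c (suc i) * p l) (λ i → c (suc i) * a i l)) ⟨
          c zero * p l + sum (λ i → c (suc i) * p l + c (suc i) * a i l)
            ≈⟨ +-congˡ (sum-cong-≋ λ i → sym (distribˡ (c (suc i)) (p l) (a i l))) ⟩
          combination c q l
            ≈⟨ combination≈0 l ⟩
          0# ∎

    best : ∀ w → ∃ λ (s : R) → InUnitInterval s × (∀ {t} → InUnitInterval t → 0# ≤ (s - t) * w)
    best w with ≤.total 0# w
    ... | inj₁ 0≤w = 1# , 1∈[0,1] , λ (_ , t≤1) → *-nonNeg (x≤y⇒0≤y-x t≤1) 0≤w
    ... | inj₂ w≤0 = 0# , 0∈[0,1] , λ { {t} (0≤t , _) → ≤.≤-respʳ-≈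
            (solve 2 (λ t w → t :* (con (+ 0) :- w) := (con (+ 0) :- t) :* w) refl t w)
            (*-nonNeg 0≤t (x≤y⇒0≤y-x w≤0)) }

    -- Otherwise moving t i towards s would increase u beyond its maximum c.
    extremal : ∀ i → ¬ w i ≈ 0# → ∃ λ (s : R) → InUnitInterval s ×
      (∀ {t : Vector R (suc d)} → (∀ j → InUnitInterval (t j)) → u ∙ p + sum (λ j → t j * w j) ≈ c → t i ≈ s)
    extremal i wi≉0 with best (w i)
    ... | s , s∈ , s-best = s , s∈ , forced
      where
      forced : ∀ {t : Vector R (suc d)} → (∀ j → InUnitInterval (t j)) → u ∙ p + sum (λ j → t j * w j) ≈ c → t i ≈ s
      forced {t} bounds u≈c = sym (x-y≈0⇒x≈y (x*y≈0⇒y≈0 wi≉0 (trans (*-comm _ _)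
          (≤.antisym gain≤0 (s-best (bounds i))))))
        where
        t′ : Fin (suc d) → R
        -- This is t with its i-th entry replaced by s, written so that the change of the functional
        -- collapses by `sum-δ`.
        t′ j = t j + (s - t i) * δ i j
        bounds′ : ∀ j → InUnitInterval (t′ j)
        bounds′ j with i ≟ j
        ... | yes ≡.refl = [0,1]-resp-≈ (solve 2 (λ s t → s := t :+ (s :- t) :* con (+ 1)) refl s (t i)) s∈
        ... | no  _      = [0,1]-resp-≈ (solve 3 (λ s t t′ → t′ := t′ :+ (s :- t) :* con (+ 0)) refl s (t i) (t j)) (bounds j)
        gain : u ∙ p + sum (λ j → t′ j * w j) ≈ c + (s - t i) * w i
        gain = begin
          u ∙ p + sum (λ j → t′ j * w j)
            ≈⟨ +-congˡ (sum-cong-≋ λ j → solve 4 (λ t e δ w → (t :+ e :* δ) :* w := t :* w :+ e :* (δ :* w)) refl (t j) (s - t i) (δ i j) (w j)) ⟩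
          u ∙ p + sum (λ j → t j * w j + (s - t i) * (δ i j * w j))
            ≈⟨ +-congˡ (∑-distrib-+ (λ j → t j * w j) (λ j → (s - t i) * (δ i j * w j))) ⟩
          u ∙ p + (sum (λ j → t j * w j) + sum (λ j → (s - t i) * (δ i j * w j)))
            ≈⟨ +-assoc _ _ _ ⟨
          u ∙ p + sum (λ j → t j * w j) + sum (λ j → (s - t i) * (δ i j * w j))
            ≈⟨ +-cong u≈c (trans (sym (*-distribˡ-sum (s - t i) (λ j → δ i j * w j))) (*-congˡ (sum-δ i w))) ⟩
          c + (s - t i) * w i ∎
        gain≤0 : (s - t i) * w i ≤ 0#
        gain≤0 = ≤-by (x≤y⇒0≤y-x (≤.≤-respˡ-≈ (trans (u∙point t′ (λ _ → refl)) gain)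
                   (u≤c _ (P⊇ (t′ , bounds′ , λ _ → refl)))))
                 (solve 2 (λ c g → con (+ 0) :- g := c :- (c :+ g)) refl c ((s - t i) * w i))

    not-two : ∀ i l → ¬ w i ≈ 0# → ¬ w (punchIn i l) ≈ 0# → ¬ AffinelyIndependent pts
    not-two i l wi≉0 wj≉0 = two-fixed-coordinates {p = p} {a} {pts} T pts≋ i l
        (λ k → proj₂ (proj₂ (extremal i wi≉0)) {T k} (T-bounds k) (T-maximal k))
        (λ k → proj₂ (proj₂ (extremal (punchIn i l) wj≉0)) {T k} (T-bounds k) (T-maximal k))

    face-at : ∀ i → ¬ w i ≈ 0# → (∀ l → w (punchIn i l) ≈ 0#) →
              ∃ λ (i : Fin (suc d)) → ∃ λ (q : Point N) → F ≐ parallelepiped q (removeAt a i)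
    face-at i wi≉0 others≈0 = i , q , F⊆q , q⊆F
      where
      s = proj₁ (extremal i wi≉0)
      s∈ : InUnitInterval s
      s∈ = proj₁ (proj₂ (extremal i wi≉0))
      forced : ∀ (t : Vector R (suc d)) → (∀ j → InUnitInterval (t j)) → u ∙ p + sum (λ j → t j * w j) ≈ c → t i ≈ s
      forced t = proj₂ (proj₂ (extremal i wi≉0)) {t}
      q : Point N
      q l = p l + s * a i l
      only-i : ∀ (t : Vector R (suc d)) → sum (λ j → t j * w j) ≈ t i * w i
      only-i t = trans (sum-remove {i = i} (λ j → t j * w j))
        (trans (+-congˡ (sum-zero λ l → trans (*-congˡ (others≈0 l)) (zeroʳ (t (punchIn i l))))) (+-identityʳ (t i * w i)))
      u∙p+s*w≈c : u ∙ p + s * w i ≈ c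
      u∙p+s*w≈c = trans (+-congˡ (sym (trans (only-i (T zero)) (*-congʳ (forced (T zero) (T-bounds zero) (T-maximal zero))))))
        (T-maximal zero)
      F⊆q : F ⊆ parallelepiped q (removeAt a i)
      F⊆q x∈F with F-coordinates x∈F
      ... | t , bounds , eq , u≈c = removeAt t i , (λ j → bounds (punchIn i j)) , λ l → trans (eq l)
            (trans (parallelepiped-remove p a t i l) (+-congʳ (+-congˡ (*-congʳ (forced t bounds u≈c)))))
      q⊆F : parallelepiped q (removeAt a i) ⊆ F
      q⊆F (t , bounds , eq) = F-from (insertAt t i s) (all-insertAt {Q = InUnitInterval} t i s∈ bounds)
        (λ l → trans (eq l) (sym (parallelepiped-insert p a t i s l)))
        (trans (+-congˡ (trans (only-i (insertAt t i s)) (*-congʳ (reflexive (insertAt-lookup t i s))))) u∙p+s*w≈c)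

    face : ∃ λ (i : Fin (suc d)) → ∃ λ (q : Point N) → F ≐ parallelepiped q (removeAt a i)
    face with any? (λ i → ¬? (w i ≤.≟ 0#))
    ... | no all≈0 = contradiction (λ i → decidable-stable (w i ≤.≟ 0#) λ wi≉0 → all≈0 (i , wi≉0)) not-constant
    ... | yes (i , wi≉0) with any? (λ l → ¬? (w (punchIn i l) ≤.≟ 0#))
    ...   | yes (l , wj≉0) = contradiction pts-independent (not-two i l wi≉0 wj≉0)
    ...   | no  others     = face-at i wi≉0 λ l →
              decidable-stable (w (punchIn i l) ≤.≟ 0#) λ wj≉0 → others (l , wj≉0)

  -- Congruence of facets

  -- The isometry is x ↦ q + L (x - p); coefficients are permuted along with the generators.
  parallelepiped-≅ : (L : Point N → Point N) →
    (∀ x y → (L x -ᵥ L y) ∙ (L x -ᵥ L y) ≈ (x -ᵥ y) ∙ (x -ᵥ y)) →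
    (∀ {x y} → x ≋ y → L x ≋ L y) →
    (∀ (t : Vector R d) b → L (combination t b) ≋ combination t (L ∘ b)) →
    {a b : Vector (Point N) d} (π : Permutation′ d) → (∀ i → L (a i) ≋ b (π ⟨$⟩ʳ i)) →
    (p q : Point N) → parallelepiped p a ≅ parallelepiped q b
  parallelepiped-≅ L isometry L-cong linear {a} {b} π La≋b p q =
    f , f-isometry ,
    (λ { (x , (t , bounds , x≋) , y≋fx) → t ∘ (π ⟨$⟩ˡ_) , bounds ∘ (π ⟨$⟩ˡ_) , λ l → begin
      _                                      ≈⟨ y≋fx l ⟩
      q l + L (x -ᵥ p) l                     ≈⟨ +-congˡ (f-combination x≋ l) ⟩
      q l + combination t (b ∘ (π ⟨$⟩ʳ_)) l  ≈⟨ +-congˡ (sum-cong-≋ λ i → *-congʳ {b (π ⟨$⟩ʳ i) l} (reflexive (≡.cong t (≡.sym (Perm.inverseˡ π {i}))))) ⟩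
      q l + combination (t ∘ (π ⟨$⟩ˡ_) ∘ (π ⟨$⟩ʳ_)) (b ∘ (π ⟨$⟩ʳ_)) l
                                             ≈⟨ +-congˡ (combination-permute π (t ∘ (π ⟨$⟩ˡ_)) b l) ⟨
      q l + combination (t ∘ (π ⟨$⟩ˡ_)) b l  ∎ }) ,
    (λ (t , bounds , y≋) → p +ᵥ combination (t ∘ (π ⟨$⟩ʳ_)) a ,
      (t ∘ (π ⟨$⟩ʳ_) , bounds ∘ (π ⟨$⟩ʳ_) , λ _ → refl) ,
      λ l → trans (y≋ l) (+-congˡ (trans (combination-permute π t b l) (sym (f-combination (λ _ → refl) l)))))
    where
    f : Point _ → Point _
    f x = q +ᵥ L (x -ᵥ p)
    f-isometry : IsIsometry f
    f-isometry = preserves-∙⇒isometry λ x y → begin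
      (f x -ᵥ f y) ∙ (f x -ᵥ f y)
        ≈⟨ ∙-cong (λ l → translate x y l) (λ l → translate x y l) ⟩
      (L (x -ᵥ p) -ᵥ L (y -ᵥ p)) ∙ (L (x -ᵥ p) -ᵥ L (y -ᵥ p))
        ≈⟨ isometry (x -ᵥ p) (y -ᵥ p) ⟩
      ((x -ᵥ p) -ᵥ (y -ᵥ p)) ∙ ((x -ᵥ p) -ᵥ (y -ᵥ p))
        ≈⟨ ∙-cong (λ l → cancel x y l) (λ l → cancel x y l) ⟩
      (x -ᵥ y) ∙ (x -ᵥ y) ∎
      where
      translate : ∀ x y → f x -ᵥ f y ≋ L (x -ᵥ p) -ᵥ L (y -ᵥ p)
      translate x y l = solve 3 (λ q x y → (q :+ x) :- (q :+ y) := x :- y) refl (q l) (L (x -ᵥ p) l) (L (y -ᵥ p) l)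
      cancel : ∀ x y → (x -ᵥ p) -ᵥ (y -ᵥ p) ≋ x -ᵥ y
      cancel x y l = solve 3 (λ p x y → (x :- p) :- (y :- p) := x :- y) refl (p l) (x l) (y l)
    f-combination : ∀ {x t} → x ≋ p +ᵥ combination t a → L (x -ᵥ p) ≋ combination t (b ∘ (π ⟨$⟩ʳ_))
    f-combination {x} {t} x≋ l = begin
      L (x -ᵥ p) l             ≈⟨ L-cong (λ l → trans (+-congʳ (x≋ l)) (solve 2 (λ p c → (p :+ c) :- p := c) refl (p l) (combination t a l))) l ⟩
      L (combination t a) l    ≈⟨ linear t a l ⟩
      combination t (L ∘ a) l  ≈⟨ combination-cong (λ _ → refl) La≋b l ⟩
      combination t (b ∘ (π ⟨$⟩ʳ_)) l ∎

  -- The reflection in the hyperplane orthogonal to w, if w ∙ w ≈ 2.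
  reflection : Point N → Point N → Point N
  reflection w x l = x l - (w ∙ x) * w l

  module _ {N : ℕ} (w : Point N) where

    ∙-reflection : (x y : Point N) (c : R) → x ∙ (λ l → y l - c * w l) ≈ x ∙ y - c * (w ∙ x)
    ∙-reflection x y c = trans (∙-distribˡ-- x y (λ l → c * w l))
      (+-congˡ (-‿cong (trans (∙-comm x (λ l → c * w l)) (∙-*ˡ c w x))))

    reflection-cong : ∀ {x y} → x ≋ y → reflection w x ≋ reflection w y
    reflection-cong x≋y l = +-cong (x≋y l) (-‿cong (*-congʳ (∙-cong {x = w} (λ _ → refl) x≋y)))

    reflection-linear : (t : Vector R d) (b : Vector (Point N) d) →
                        reflection w (combination t b) ≋ combination t (reflection w ∘ b)
    reflection-linear t b l = begin
      combination t b l - (w ∙ combination t b) * w l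
        ≈⟨ +-congˡ (-‿cong (*-congʳ (∙-combination w t b))) ⟩
      combination t b l - sum (λ i → t i * (w ∙ b i)) * w l
        ≈⟨ +-congˡ (-‿cong (*-distribʳ-sum (w l) (λ i → t i * (w ∙ b i)))) ⟩
      combination t b l - sum (λ i → t i * (w ∙ b i) * w l)
        ≈⟨ sum-- (λ i → t i * b i l) (λ i → t i * (w ∙ b i) * w l) ⟨
      sum (λ i → t i * b i l - t i * (w ∙ b i) * w l)
        ≈⟨ sum-cong-≋ (λ i → solve 4 (λ t b c w → t :* b :- t :* c :* w := t :* (b :- c :* w)) refl (t i) (b i l) (w ∙ b i) (w l)) ⟩
      combination t (reflection w ∘ b) l ∎

    reflection-isometry : w ∙ w ≈ 1# + 1# → ∀ x y →
      (reflection w x -ᵥ reflection w y) ∙ (reflection w x -ᵥ reflection w y) ≈ (x -ᵥ y) ∙ (x -ᵥ y)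
    reflection-isometry w∙w≈2 x y = begin
      (reflection w x -ᵥ reflection w y) ∙ (reflection w x -ᵥ reflection w y)
        ≈⟨ ∙-cong difference difference ⟩
      z ∙ z
        ≈⟨ ∙-reflection z D κ ⟩
      z ∙ D - κ * (w ∙ z)
        ≈⟨ +-cong (trans (∙-comm z D) (∙-reflection D D κ)) (-‿cong (*-congˡ (∙-reflection w D κ))) ⟩
      D ∙ D - κ * (w ∙ D) - κ * (w ∙ D - κ * (w ∙ w))
        ≈⟨ +-congˡ (-‿cong (*-congˡ (+-congˡ (-‿cong (*-congˡ w∙w≈2))))) ⟩
      D ∙ D - κ * κ - κ * (κ - κ * (1# + 1#))
        ≈⟨ solve 2 (λ D κ → (D :- κ :* κ) :- κ :* (κ :- κ :* (con (+ 1) :+ con (+ 1))) := D) refl (D ∙ D) κ ⟩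
      D ∙ D ∎
      where
      D = x -ᵥ y
      κ = w ∙ D
      z : Point N
      z l = D l - κ * w l
      difference : reflection w x -ᵥ reflection w y ≋ z
      difference l = trans
        (solve 5 (λ x y a b w → (x :- a :* w) :- (y :- b :* w) := (x :- y) :- (a :- b) :* w) refl
          (x l) (y l) (w ∙ x) (w ∙ y) (w l))
        (+-congˡ (-‿cong (*-congʳ (sym (∙-distribˡ-- w x y)))))

  -- The Gram matrix is I - β J, with J the all-ones matrix: equal lengths and equal angles.
  -- Subfamilies inherit it with the same β, which is what an induction over facets requires.
  HasGram : R → Vector (Point N) d → Set
  HasGram β a = ∀ i j → a i ∙ a j ≈ δ i j - β

  removeAt-gram : {β : R} (a : Vector (Point N) (suc d)) (i : Fin (suc d)) → HasGram β a → HasGram β (removeAt a i)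
  removeAt-gram a i gram j k = trans (gram _ _) (+-congʳ (reflexive (δ-punchIn i j k)))

  transpose-first : (i j : Fin n) → Perm.transpose i j ⟨$⟩ʳ i ≡ j
  transpose-first i j rewrite dec-true (i ≟ i) ≡.refl = ≡.refl

  -- The left side is one coordinate of the reflected generator, once `gram-difference` has
  -- evaluated the inner product.
  transpose-lookup : (f : Vector R d) {i j : Fin d} → i ≢ j → ∀ k →
    f k - (δ k i - δ k j) * (f i - f j) ≈ f (Perm.transpose i j ⟨$⟩ʳ k)
  transpose-lookup f {i} {j} i≢j k with k ≟ i
  ... | yes ≡.refl = trans (+-congˡ (-‿cong (*-congʳ (+-congˡ (-‿cong (reflexive (δ-≢ i≢j)))))))
    (solve 2 (λ x y → x :- (con (+ 1) :- con (+ 0)) :* (x :- y) := y) refl (f i) (f j))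
  ... | no  _ with k ≟ j
  ...   | yes ≡.refl = solve 2 (λ x y → y :- (con (+ 0) :- con (+ 1)) :* (x :- y) := x) refl (f i) (f j)
  ...   | no  _      = solve 3 (λ x y z → z :- (con (+ 0) :- con (+ 0)) :* (x :- y) := z) refl (f i) (f j) (f k)

  -- β cancels, so differences of generators pair with generators as they would in an orthonormal
  -- family.
  gram-difference : {β : R} (a : Vector (Point N) d) → HasGram β a → ∀ i j k →
                    (a i -ᵥ a j) ∙ a k ≈ δ k i - δ k j
  gram-difference {β = β} a gram i j k = begin
    (a i -ᵥ a j) ∙ a k             ≈⟨ ∙-comm (a i -ᵥ a j) (a k) ⟩
    a k ∙ (a i -ᵥ a j)             ≈⟨ ∙-distribˡ-- (a k) (a i) (a j) ⟩
    a k ∙ a i - a k ∙ a j          ≈⟨ +-cong (gram k i) (-‿cong (gram k j)) ⟩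
    (δ k i - β) - (δ k j - β)      ≈⟨ solve 3 (λ d e β → (d :- β) :- (e :- β) := d :- e) refl (δ k i) (δ k j) β ⟩
    δ k i - δ k j                  ∎

  reflection-transposes : {β : R} (a : Vector (Point N) d) → HasGram β a → ∀ {i j} → i ≢ j → ∀ k →
                          reflection (a i -ᵥ a j) (a k) ≋ a (Perm.transpose i j ⟨$⟩ʳ k)
  reflection-transposes a gram {i} {j} i≢j k l = trans
    (+-congˡ (-‿cong (*-congʳ (gram-difference a gram i j k))))
    (transpose-lookup (λ k → a k l) i≢j k)

  removeAt-congruent : (a : Vector (Point N) (suc d)) {β : R} → HasGram β a → ∀ i j p q →
    parallelepiped p (removeAt a i) ≅ parallelepiped q (removeAt a j)
  removeAt-congruent a gram i j p q with i ≟ j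
  -- Facets that omit the same generator are translates of each other.
  ... | yes ≡.refl = parallelepiped-≅ id (λ _ _ → refl) (λ x≋y → x≋y) (λ _ _ _ → refl) Perm.id (λ _ _ → refl) p q
  ... | no  i≢j    = parallelepiped-≅ (reflection w) (reflection-isometry w w∙w≈2) (reflection-cong w)
      (reflection-linear w) (Perm.remove i (Perm.transpose i j)) maps p q
    where
    w = a i -ᵥ a j
    w∙w≈2 : w ∙ w ≈ 1# + 1#
    w∙w≈2 = begin
      w ∙ w                                ≈⟨ ∙-distribˡ-- w (a i) (a j) ⟩
      w ∙ a i - w ∙ a j                    ≈⟨ +-cong (gram-difference a gram i j i) (-‿cong (gram-difference a gram i j j)) ⟩
      (δ i i - δ i j) - (δ j i - δ j j)    ≡⟨ ≡.cong₂ (λ x y → (x - δ i j) - (δ j i - y)) (δ-refl i) (δ-refl j) ⟩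
      (1# - δ i j) - (δ j i - 1#)          ≡⟨ ≡.cong₂ (λ x y → (1# - x) - (y - 1#)) (δ-≢ i≢j) (δ-≢ (i≢j ∘ ≡.sym)) ⟩
      (1# - 0#) - (0# - 1#)                ≈⟨ solve 0 ((con (+ 1) :- con (+ 0)) :- (con (+ 0) :- con (+ 1)) := con (+ 1) :+ con (+ 1)) refl ⟩
      1# + 1#                              ∎
    maps : ∀ l → reflection w (a (punchIn i l)) ≋ a (punchIn j (Perm.remove i (Perm.transpose i j) ⟨$⟩ʳ l))
    maps l m = trans (reflection-transposes a gram i≢j (punchIn i l) m)
      (reflexive (≡.cong (λ k → a k m) (≡.trans (Perm.punchIn-permute (Perm.transpose i j) i l)
        (≡.cong (λ k → punchIn k (Perm.remove i (Perm.transpose i j) ⟨$⟩ʳ l)) (transpose-first i j)))))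

  -- Induction on the dimension: a facet omits one generator, which preserves independence and the
  -- Gram condition. In dimension 2, equal diagonal Gram entries give equal sides.
  isHyperRhombus : ∀ m {N} (p : Point N) (a : Vector (Point N) (2 ℕ.+ m)) {β : R} →
    LinearlyIndependent a → HasGram β a → {P : PointSet N} → P ≐ parallelepiped p a → IsHyperRhombus (2 ℕ.+ m) P
  isHyperRhombus zero    p a independent gram P≐ =
    rhombus (p , a , independent , P≐ , √-cong (trans (gram zero zero) (sym (gram (suc zero) (suc zero)))))
  isHyperRhombus (suc m) {N} p a {β} independent gram {P} P≐ = higher (p , a , independent , P≐)
      (λ F F-face → facet-isHyperRhombus (facet p a independent P≐ F-face))
      (λ F G F-face G-face → facets-congruent (facet p a independent P≐ F-face) (facet p a independent P≐ G-face))
    where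
    IsFacet : PointSet N → Set
    IsFacet F = ∃ λ (i : Fin (3 ℕ.+ m)) → ∃ λ (q : Point N) → F ≐ parallelepiped q (removeAt a i)
    facet-isHyperRhombus : {F : PointSet N} → IsFacet F → IsHyperRhombus (2 ℕ.+ m) F
    facet-isHyperRhombus (i , q , F≐) =
      isHyperRhombus m q (removeAt a i) {β} (removeAt-independent a i independent) (removeAt-gram a i gram) F≐
    facets-congruent : {F G : PointSet N} → IsFacet F → IsFacet G → F ≅ G
    facets-congruent (i , q , F≐) (j , r , G≐) =
      ≅-resp-≐ (proj₂ F≐ , proj₁ F≐) (proj₂ G≐ , proj₁ G≐) (removeAt-congruent a {β} gram i j q r)

-- Coordinate descriptions of the cells

module LatticeCells (ℝ : CompleteOrderedField) where

  open Ordered ℝ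
  open Geometry ℝ
  open Euclidean ℝ
  open HyperRhombic ℝ
  open FinitePermutations
  open import Relation.Binary.Reasoning.Setoid setoid

  private
    variable
      N n : ℕ

  ·ℕ-nonNeg : ∀ n → 0# ≤ n ·ℕ 1#
  ·ℕ-nonNeg zero    = ≤.refl
  ·ℕ-nonNeg (suc n) = +-nonNeg 0≤1 (·ℕ-nonNeg n)

  suc·ℕ≉0 : ∀ n → ¬ suc n ·ℕ 1# ≈ 0#
  suc·ℕ≉0 n = proj₂ (+-posˡ 0<1 (·ℕ-nonNeg n)) ∘ sym

  maximum : (x : Vector R (suc n)) → ∃ λ i → ∀ j → x j ≤ x i
  maximum {zero}  x = zero , λ { zero → ≤.refl }
  maximum {suc n} x with maximum (λ i → x (suc i))
  ... | i , max with ≤.total (x zero) (x (suc i))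
  ...   | inj₁ x₀≤xᵢ = suc i , λ { zero → x₀≤xᵢ ; (suc j) → max j }
  ...   | inj₂ xᵢ≤x₀ = zero  , λ { zero → ≤.refl ; (suc j) → ≤.trans (max j) xᵢ≤x₀ }

  minimum : (x : Vector R (suc n)) → ∃ λ i → ∀ j → x i ≤ x j
  minimum x with maximum (λ i → - x i)
  ... | i , max = i , λ j → ≤-by (x≤y⇒0≤y-x (max j))
    (solve 2 (λ x y → y :- x := (:- x) :- (:- y)) refl (x i) (x j))

  -- Selection sort in descending order: a largest entry goes first.
  sort : (x : Vector R n) → ∃ λ (π : Permutation′ n) → ∀ {i j} → i Fin.≤ j → x (π ⟨$⟩ʳ j) ≤ x (π ⟨$⟩ʳ i)
  sort {zero}  x = Perm.id , λ { {()} }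
  sort {suc n} x with maximum x
  ... | i₀ , max with sort (λ i → x (punchIn i₀ i))
  ...   | π , sorted = Perm.insert zero i₀ π , λ
          { {zero}  {j}     _         → max (Perm.insert zero i₀ π ⟨$⟩ʳ j)
          ; {suc i} {suc j} (s≤s i≤j) → sorted i≤j }

  -- The coefficient of ξ i in `v n k`. The boolean comparison reduces under `suc`, so inductions on
  -- indices compute.
  χ : Fin n → Fin n → R
  χ i k = if toℕ i <ᵇ toℕ k then 1# else 0#

  χ∈[0,1] : (i k : Fin n) → InUnitInterval (χ i k)
  χ∈[0,1] i k with toℕ i <ᵇ toℕ k
  ... | true  = 1∈[0,1]
  ... | false = 0∈[0,1]

  χ-< : {i k : Fin n} → i Fin.< k → χ i k ≡ 1#
  χ-< {i = zero}  {suc k} _         = ≡.refl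
  χ-< {i = suc i} {suc k} (s≤s i<k) = χ-< {i = i} {k} i<k

  χ-≥ : {i k : Fin n} → k Fin.≤ i → χ i k ≡ 0#
  χ-≥ {i = i}     {zero}  _         = ≡.refl
  χ-≥ {i = suc i} {suc k} (s≤s k≤i) = χ-≥ {i = i} {k} k≤i

  -- For i ≤ j the difference is the indicator of i < k ≤ j.
  χ-difference : {i j : Fin n} → i Fin.≤ j → ∀ k → InUnitInterval (χ i k - χ j k)
  χ-difference {i = i} {j} i≤j k with ℕₚ.<-≤-connex (toℕ j) (toℕ k)
  ... | inj₁ j<k = [0,1]-resp-≈
    (sym (trans (+-cong (reflexive (χ-< {i = i} {k} (ℕₚ.≤-<-trans i≤j j<k))) (-‿cong (reflexive (χ-< {i = j} {k} j<k)))) (-‿inverseʳ 1#)))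
    0∈[0,1]
  ... | inj₂ k≤j = [0,1]-resp-≈
    (sym (trans (+-congˡ (-‿cong (reflexive (χ-≥ {i = j} {k} k≤j)))) (solve 1 (λ x → x :- con (+ 0) := x) refl (χ i k))))
    (χ∈[0,1] i k)

  sum-Fin′ : (j : Fin n) (f : Vector R n) → sum (λ (i : Fin′ j) → f (inject i)) ≈ sum (λ i → χ i j * f i)
  sum-Fin′ {suc n} zero f = sym (sum-zero λ i → zeroˡ (f i))
  sum-Fin′ {suc n} (suc j) f = +-cong (sym (*-identityˡ (f zero))) (sum-Fin′ j (λ i → f (suc i)))

  telescope : (i : Fin (suc n)) (x : Vector R (suc n)) →
    sum (λ (k : Fin n) → χ i (suc k) * (x (inject₁ k) - x (suc k))) ≈ x i - x (fromℕ n)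
  telescope {zero}  zero    x = sym (-‿inverseʳ (x zero))
  telescope {suc n} (suc i) x = trans
    (+-cong (zeroˡ (x zero - x (suc zero))) (telescope i (λ k → x (suc k)))) (+-identityˡ _)
  telescope {suc n} zero    x = trans
    (+-cong (*-identityˡ (x zero - x (suc zero))) (telescope zero (λ k → x (suc k))))
    (solve 3 (λ x y z → (x :- y) :+ (y :- z) := x :- z) refl (x zero) (x (suc zero)) (x (fromℕ (suc n))))

  module _ (n : ℕ) where

    private
      κ = (suc n ·ℕ 1#) ⁻¹

      κ-inverse : (suc n ·ℕ 1#) * κ ≈ 1#
      κ-inverse = ⁻¹-inverse (suc n ·ℕ 1#) (suc·ℕ≉0 n)

    H-sum : ∀ {x} → x ∈ H n → sum x ≈ 0#
    H-sum {x} x∈H = trans (sum-cong-≋ λ i → sym (*-identityʳ (x i))) x∈H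

    sum-H : ∀ {x} → sum x ≈ 0# → x ∈ H n
    sum-H {x} eq = trans (sum-cong-≋ λ i → *-identityʳ (x i)) eq

    H-resp-≋ : ∀ {x y} → x ≋ y → x ∈ H n → y ∈ H n
    H-resp-≋ {x} {y} x≋y x∈H = sum-H {y} (trans (sym (sum-cong-≋ x≋y)) (H-sum {x} x∈H))

    H-act : (π : Permutation′ (suc n)) → ∀ {x} → x ∈ H n → act π x ∈ H n
    H-act π {x} x∈H = sum-H {act π x} (trans (sym (sum-permute x (Perm.flip π))) (H-sum {x} x∈H))

    -- The right side subtracts the mean from t: combining the ξ i projects the coefficient vector
    -- orthogonally onto H.
    combination-ξ : (t : Vector R (suc n)) → combination t (ξ n) ≋ λ k → t k - κ * sum t
    combination-ξ t k = begin
      sum (λ i → t i * (δ i k - κ * 1#))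
        ≈⟨ sum-cong-≋ (λ i → solve 3 (λ t d κ → t :* (d :- κ :* con (+ 1)) := d :* t :- κ :* t) refl (t i) (δ i k) κ) ⟩
      sum (λ i → δ i k * t i - κ * t i)
        ≈⟨ sum-- (λ i → δ i k * t i) (λ i → κ * t i) ⟩
      sum (λ i → δ i k * t i) - sum (λ i → κ * t i)
        ≈⟨ +-cong (trans (sum-cong-≋ λ i → *-congʳ {t i} (reflexive (δ-comm i k))) (sum-δ k t))
                  (-‿cong (sym (*-distribˡ-sum κ t))) ⟩
      t k - κ * sum t ∎

    combination-ξ∈H : (t : Vector R (suc n)) → combination t (ξ n) ∈ H n
    combination-ξ∈H t = sum-H {combination t (ξ n)} (begin
      sum (combination t (ξ n))                ≈⟨ sum-cong-≋ (combination-ξ t) ⟩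
      sum (λ k → t k - κ * sum t)              ≈⟨ sum-- t (λ _ → κ * sum t) ⟩
      sum t - sum {suc n} (λ _ → κ * sum t)    ≈⟨ +-congˡ (-‿cong (sum-const (suc n) (κ * sum t))) ⟩
      sum t - (suc n ·ℕ 1#) * (κ * sum t)      ≈⟨ modulo (- sum t) κ-inverse
        (solve 3 (λ t m κ → (t :- m :* (κ :* t)) :- con (+ 0) := (:- t) :* (m :* κ :- con (+ 1))) refl (sum t) (suc n ·ℕ 1#) κ) ⟩
      0#                                       ∎)

    combination-ξ-difference : (t : Vector R (suc n)) → ∀ i j →
      combination t (ξ n) i - combination t (ξ n) j ≈ t i - t j
    combination-ξ-difference t i j = trans (+-cong (combination-ξ t i) (-‿cong (combination-ξ t j)))
      (solve 3 (λ x y s → (x :- s) :- (y :- s) := x :- y) refl (t i) (t j) (κ * sum t))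

    -- The hypothesis makes x - t a constant vector, and since x sums to 0 the constant is minus the
    -- mean of t.
    ≋combination-ξ : ∀ {x} (t : Vector R (suc n)) j → x ∈ H n → (∀ i → x i - x j ≈ t i - t j) →
                     x ≋ combination t (ξ n)
    ≋combination-ξ {x} t j x∈H differences k = trans (x-shift k) (trans (+-congˡ s≈) (sym (combination-ξ t k)))
      where
      s = x j - t j
      x-shift : ∀ i → x i ≈ t i + s
      x-shift i = modulo 1# (differences i)
        (solve 4 (λ x t xj tj → x :- (t :+ (xj :- tj)) := con (+ 1) :* ((x :- xj) :- (t :- tj))) refl (x i) (t i) (x j) (t j))
      total : sum t + (suc n ·ℕ 1#) * s ≈ 0#
      total = begin
        sum t + (suc n ·ℕ 1#) * s       ≈⟨ +-congˡ (sum-const (suc n) s) ⟨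
        sum t + sum {suc n} (λ _ → s)   ≈⟨ ∑-distrib-+ t (λ _ → s) ⟨
        sum (λ i → t i + s)             ≈⟨ sum-cong-≋ x-shift ⟨
        sum x                           ≈⟨ H-sum {x} x∈H ⟩
        0#                              ∎
      s≈ : s ≈ - (κ * sum t)
      s≈ = modulo κ total
        (modulo (- s) κ-inverse
          (solve 4 (λ s t m κ → (s :- (:- (κ :* t))) :- κ :* ((t :+ m :* s) :- con (+ 0)) := (:- s) :* (m :* κ :- con (+ 1))) refl s (sum t) (suc n ·ℕ 1#) κ))

    ξ-gram : HasGram κ (ξ n)
    ξ-gram i j = begin
      ξ n i ∙ ξ n j
        ≈⟨ sum-cong-≋ (λ l → solve 3 (λ d κ y → (d :- κ :* con (+ 1)) :* y := d :* y :- κ :* y) refl (δ i l) κ (ξ n j l)) ⟩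
      sum (λ l → δ i l * ξ n j l - κ * ξ n j l)
        ≈⟨ sum-- (λ l → δ i l * ξ n j l) (λ l → κ * ξ n j l) ⟩
      sum (λ l → δ i l * ξ n j l) - sum (λ l → κ * ξ n j l)
        ≈⟨ +-cong (sum-δ i (ξ n j)) (-‿cong (trans (sym (*-distribˡ-sum κ (ξ n j))) (trans (*-congˡ sum-ξ) (zeroʳ κ)))) ⟩
      δ j i - κ * 1# - 0#
        ≈⟨ solve 2 (λ d κ → (d :- κ :* con (+ 1)) :- con (+ 0) := d :- κ) refl (δ j i) κ ⟩
      δ j i - κ
        ≡⟨ ≡.cong (_- κ) (δ-comm j i) ⟩
      δ i j - κ ∎
      where
      sum-ξ : sum (ξ n j) ≈ 0#
      sum-ξ = trans (sum-cong-≋ λ k → sym (sum-δ j (λ i → ξ n i k))) (H-sum {combination (δ j) (ξ n)} (combination-ξ∈H (δ j)))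

    -- With coefficient 0 put at the missing index j, each c i is a coefficient difference, hence a
    -- coordinate difference of the zero vector.
    removeAt-ξ-independent : ∀ j → LinearlyIndependent (removeAt (ξ n) j)
    removeAt-ξ-independent j c c≈0 i = begin
      c i
        ≈⟨ solve 1 (λ x → x := x :- con (+ 0)) refl (c i) ⟩
      c i - 0#
        ≡⟨ ≡.cong₂ _-_ (insertAt-punchIn c j 0# i) (insertAt-lookup c j 0#) ⟨
      t (punchIn j i) - t j
        ≈⟨ combination-ξ-difference t (punchIn j i) j ⟨
      combination t (ξ n) (punchIn j i) - combination t (ξ n) j
        ≈⟨ +-cong (vanishes (punchIn j i)) (-‿cong (vanishes j)) ⟩
      0# - 0#
        ≈⟨ -‿inverseʳ 0# ⟩
      0# ∎
      where
      t = insertAt c j 0#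
      vanishes : combination t (ξ n) ≋ 0ᵥ
      vanishes l = trans (sum-insertAt (λ v i → v * ξ n i l) c j 0#)
        (trans (+-cong (zeroˡ (ξ n j l)) (c≈0 l)) (+-identityˡ 0#))

    -- Coefficient 0 at the missing generator ξ j fixes the free constant, so the remaining
    -- coefficients are exactly the differences x i - x j.
    ◇≐ : ∀ j → ◇ n j ≐ λ x → x ∈ H n × (∀ i → InUnitInterval (x i - x j))
    ◇≐ j = to , from
      where
      to : ◇ n j ⊆ λ x → x ∈ H n × (∀ i → InUnitInterval (x i - x j))
      to {x} (t , bounds , x≋) = H-resp-≋ {combination t′ (ξ n)} (λ l → sym (x≋′ l)) (combination-ξ∈H t′) ,
        λ i → [0,1]-resp-≈ (sym (difference i)) (all-insertAt {Q = InUnitInterval} t j 0∈[0,1] bounds i)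
        where
        t′ = insertAt t j 0#
        x≋′ : x ≋ combination t′ (ξ n)
        x≋′ l = trans (x≋ l) (sym (trans (sum-insertAt (λ v i → v * ξ n i l) t j 0#) (+-congʳ (zeroˡ (ξ n j l)))))
        difference : ∀ i → x i - x j ≈ t′ i
        difference i = begin
          x i - x j                                        ≈⟨ +-cong (x≋′ i) (-‿cong (x≋′ j)) ⟩
          combination t′ (ξ n) i - combination t′ (ξ n) j  ≈⟨ combination-ξ-difference t′ i j ⟩
          t′ i - t′ j                                      ≡⟨ ≡.cong (λ v → t′ i - v) (insertAt-lookup t j 0#) ⟩
          t′ i - 0#                                        ≈⟨ solve 1 (λ x → x :- con (+ 0) := x) refl (t′ i) ⟩
          t′ i                                             ∎
      from : (λ x → x ∈ H n × (∀ i → InUnitInterval (x i - x j))) ⊆ ◇ n j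
      from {x} (x∈H , bounds) = removeAt t j , (λ i → bounds (punchIn j i)) , λ l → begin
        x l                                                  ≈⟨ ≋combination-ξ t j x∈H (λ i → solve 2 (λ x y → x :- y := (x :- y) :- (y :- y)) refl (x i) (x j)) l ⟩
        combination t (ξ n) l                                ≈⟨ sum-remove {i = j} (λ i → t i * ξ n i l) ⟩
        t j * ξ n j l + combination (removeAt t j) (removeAt (ξ n) j) l
                                                             ≈⟨ +-congʳ (trans (*-congʳ (-‿inverseʳ (x j))) (zeroˡ (ξ n j l))) ⟩
        0# + combination (removeAt t j) (removeAt (ξ n) j) l ∎
        where
        t : Vector R (suc n)
        t i = x i - x j

    -- The sum of c k over k > i: as `v n k` contains ξ i exactly for i < k, this is the coefficient
    -- of ξ i in a combination of the vertices.
    tails : Vector R (suc n) → Vector R (suc n)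
    tails c i = sum (λ k → χ i k * c k)

    combination-v : (c : Vector R (suc n)) → combination c (v n) ≋ combination (tails c) (ξ n)
    combination-v c l = begin
      sum (λ k → c k * v n k l)
        ≈⟨ sum-cong-≋ (λ k → *-congˡ {c k} (sum-Fin′ k (λ i → ξ n i l))) ⟩
      sum (λ k → c k * sum (λ i → χ i k * ξ n i l))
        ≈⟨ sum-cong-≋ (λ k → *-distribˡ-sum (c k) (λ i → χ i k * ξ n i l)) ⟩
      sum (λ k → sum (λ i → c k * (χ i k * ξ n i l)))
        ≈⟨ ∑-comm (λ k i → c k * (χ i k * ξ n i l)) ⟩
      sum (λ i → sum (λ k → c k * (χ i k * ξ n i l)))
        ≈⟨ sum-cong-≋ (λ i → sum-cong-≋ λ k → solve 3 (λ c χ y → c :* (χ :* y) := χ :* c :* y) refl (c k) (χ i k) (ξ n i l)) ⟩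
      sum (λ i → sum (λ k → χ i k * c k * ξ n i l))
        ≈⟨ sum-cong-≋ (λ i → sym (*-distribʳ-sum (ξ n i l) (λ k → χ i k * c k))) ⟩
      combination (tails c) (ξ n) l ∎

    tails-fromℕ : (c : Vector R (suc n)) → tails c (fromℕ n) ≈ 0#
    tails-fromℕ c = sum-zero λ k → trans (*-congʳ {c k} (reflexive (χ-≥ {i = fromℕ n} {k} (Finₚ.≤fromℕ k)))) (zeroˡ (c k))

    tails-difference : (c : Vector R (suc n)) → ∀ i j → tails c i - tails c j ≈ sum (λ k → (χ i k - χ j k) * c k)
    tails-difference c i j = trans (sym (sum-- (λ k → χ i k * c k) (λ k → χ j k * c k)))
      (sum-cong-≋ λ k → solve 3 (λ x y c → x :* c :- y :* c := (x :- y) :* c) refl (χ i k) (χ j k) (c k))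

    -- Consecutive tails differ in a single term, so the vertex weights can be read off from
    -- coordinate differences.
    tails-step : (c : Vector R (suc n)) → ∀ k → tails c (inject₁ k) - tails c (suc k) ≈ c (suc k)
    tails-step c k = trans (tails-difference c (inject₁ k) (suc k)) (trans
      (sum-cong-≋ λ l → *-congʳ {c l} (step k l)) (sum-δ (suc k) c))
      where
      step : ∀ {n} (k : Fin n) (l : Fin (suc n)) → χ (inject₁ k) l - χ (suc k) l ≈ δ (suc k) l
      step zero    zero          = -‿inverseʳ 0#
      step zero    (suc zero)    = solve 0 (con (+ 1) :- con (+ 0) := con (+ 1)) refl
      step zero    (suc (suc l)) = -‿inverseʳ 1#
      step (suc k) zero          = -‿inverseʳ 0#
      step (suc k) (suc l)       = step k l

    -- The vertex `v n zero` is the origin, so its weight is invisible in the combination and is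
    -- recovered from the vanishing sum of weights.
    v-independent : AffinelyIndependent (v n)
    v-independent c sum-c≈0 c≈0 = λ where
        zero    → trans (sym (trans (+-congˡ (sum-zero suc≈0)) (+-identityʳ (c zero)))) sum-c≈0
        (suc k) → suc≈0 k
      where
      vanishes : combination (tails c) (ξ n) ≋ 0ᵥ
      vanishes l = trans (sym (combination-v c l)) (c≈0 l)
      suc≈0 : ∀ k → c (suc k) ≈ 0#
      suc≈0 k = begin
        c (suc k)                                ≈⟨ tails-step c k ⟨
        tails c (inject₁ k) - tails c (suc k)    ≈⟨ combination-ξ-difference (tails c) (inject₁ k) (suc k) ⟨
        combination (tails c) (ξ n) (inject₁ k) - combination (tails c) (ξ n) (suc k)
                                                 ≈⟨ +-cong (vanishes (inject₁ k)) (-‿cong (vanishes (suc k))) ⟩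
        0# - 0#                                  ≈⟨ -‿inverseʳ 0# ⟩
        0#                                       ∎

    σ₀≐ : σ₀ n ≐ λ x → x ∈ H n × (∀ {i j} → i Fin.≤ j → InUnitInterval (x i - x j))
    σ₀≐ = to , from
      where
      to : σ₀ n ⊆ λ x → x ∈ H n × (∀ {i j} → i Fin.≤ j → InUnitInterval (x i - x j))
      to {x} (c , 0≤c , sum-c≈1 , x≋) =
          H-resp-≋ {combination (tails c) (ξ n)} (λ l → sym (x≋′ l)) (combination-ξ∈H (tails c)) , bounds
        where
        x≋′ : x ≋ combination (tails c) (ξ n)
        x≋′ l = trans (x≋ l) (combination-v c l)
        bounds : ∀ {i j} → i Fin.≤ j → InUnitInterval (x i - x j)
        bounds {i} {j} i≤j = [0,1]-resp-≈ (sym difference)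
          ( sum-nonNeg (λ k → *-nonNeg (proj₁ (χ-difference {i = i} {j} i≤j k)) (0≤c k))
          , ≤.≤-respʳ-≈ sum-c≈1 (sum-mono-≤ λ k → ≤-by (*-nonNeg (x≤y⇒0≤y-x (proj₂ (χ-difference {i = i} {j} i≤j k))) (0≤c k))
              (solve 2 (λ χ c → c :- χ :* c := (con (+ 1) :- χ) :* c) refl (χ i k - χ j k) (c k))))
          where
          -- A partial sum of convex weights, over i < k ≤ j, and therefore between 0 and 1.
          difference : x i - x j ≈ sum (λ k → (χ i k - χ j k) * c k)
          difference = begin
            x i - x j                                                        ≈⟨ +-cong (x≋′ i) (-‿cong (x≋′ j)) ⟩
            combination (tails c) (ξ n) i - combination (tails c) (ξ n) j    ≈⟨ combination-ξ-difference (tails c) i j ⟩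
            tails c i - tails c j                                            ≈⟨ tails-difference c i j ⟩
            sum (λ k → (χ i k - χ j k) * c k)                                ∎
      from : (λ x → x ∈ H n × (∀ {i j} → i Fin.≤ j → InUnitInterval (x i - x j))) ⊆ σ₀ n
      from {x} (x∈H , bounds) = c , 0≤c , sum-c≈1 , λ l →
          trans (≋combination-ξ (tails c) (fromℕ n) x∈H differences l) (sym (combination-v c l))
        where
        steps : Vector R n
        steps k = x (inject₁ k) - x (suc k)
        c : Vector R (suc n)
        -- The barycentric coordinates are the drops between consecutive coordinates; the origin
        -- takes the slack left by the total drop.
        c zero    = 1# - (x zero - x (fromℕ n))
        c (suc k) = steps k
        0≤c : ∀ k → 0# ≤ c k
        0≤c zero    = x≤y⇒0≤y-x (proj₂ (bounds {zero} {fromℕ n} z≤n))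
        0≤c (suc k) = proj₁ (bounds {inject₁ k} {suc k} (ℕₚ.≤-trans (ℕₚ.≤-reflexive (Finₚ.toℕ-inject₁ k)) (ℕₚ.n≤1+n (toℕ k))))
        sum-c≈1 : sum c ≈ 1#
        sum-c≈1 = trans
          (+-congˡ (trans (sum-cong-≋ λ k → sym (*-identityˡ (steps k))) (telescope zero x)))
          (solve 1 (λ x → (con (+ 1) :- x) :+ x := con (+ 1)) refl (x zero - x (fromℕ n)))
        differences : ∀ i → x i - x (fromℕ n) ≈ tails c i - tails c (fromℕ n)
        differences i = sym (begin
          tails c i - tails c (fromℕ n)    ≈⟨ +-cong (+-cong (zeroˡ (c zero)) (telescope i x)) (-‿cong (tails-fromℕ c)) ⟩
          0# + (x i - x (fromℕ n)) - 0#    ≈⟨ solve 1 (λ x → con (+ 0) :+ x :- con (+ 0) := x) refl (x i - x (fromℕ n)) ⟩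
          x i - x (fromℕ n)                ∎)

    -- The Voronoi cell

    norm²-difference : (x q : Point (suc n)) → (x -ᵥ q) ∙ (x -ᵥ q) ≈ x ∙ x + sum (λ l → q l * q l - (x l + x l) * q l)
    norm²-difference x q = trans
      (sum-cong-≋ λ l → solve 2 (λ x q → (x :- q) :* (x :- q) := x :* x :+ (q :* q :- (x :+ x) :* q)) refl (x l) (q l))
      (∑-distrib-+ (λ l → x l * x l) (λ l → q l * q l - (x l + x l) * q l))

    e-difference∈A : ∀ i j → (λ l → δ i l - δ j l) ∈ A n
    e-difference∈A i j = integral , sum-H {λ l → δ i l - δ j l} (trans (sum-- (δ i) (δ j)) (trans (+-cong (sum-δ₁ i) (-‿cong (sum-δ₁ j))) (-‿inverseʳ 1#)))
      where
      sum-δ₁ : ∀ i → sum (δ i) ≈ 1#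
      sum-δ₁ i = trans (sum-cong-≋ λ l → sym (*-identityʳ (δ i l))) (sum-δ i (λ _ → 1#))
      integral : ∀ l → ∃ λ z → δ i l - δ j l ≈ fromℤ z
      integral l with does (i ≟ l) | does (j ≟ l)
      ... | true  | true  = + 0 , -‿inverseʳ 1#
      ... | true  | false = + 1 , +-congˡ -0#≈0#
      ... | false | true  = -[1+ 0 ] , trans (+-identityˡ (- 1#)) (-‿cong (sym (+-identityʳ 1#)))
      ... | false | false = + 0 , -‿inverseʳ 0#

    -- Summed over the coordinates with y = x - min x and Σ q = 0, this gives
    -- 2 (x ∙ q) ≤ q ∙ q, that is, ‖ x ‖ ≤ ‖ x - q ‖.
    integer-bound : ∀ z {q y} → q ≈ fromℤ z → InUnitInterval y → 0# ≤ (q * q + q) - (y + y) * q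
    integer-bound (+ m) {q} {y} q≈m (0≤y , y≤1) = ≤.≤-respʳ-≈
        (solve 2 (λ q y → q :* (q :- con (+ 1)) :+ ((con (+ 1) :- y) :* q :+ (con (+ 1) :- y) :* q) := (q :* q :+ q) :- (y :+ y) :* q) refl q y)
        (+-nonNeg (≤.≤-respʳ-≈ (*-cong (sym q≈m) (+-congʳ (sym q≈m))) (m[m-1]≥0 m)) (+-nonNeg h h))
      where
      h : 0# ≤ (1# - y) * q
      h = *-nonNeg (x≤y⇒0≤y-x y≤1) (≤.≤-respʳ-≈ (sym q≈m) (·ℕ-nonNeg m))
      -- Integrality of q enters here: q (q - 1) is negative strictly between 0 and 1.
      m[m-1]≥0 : ∀ m → 0# ≤ (m ·ℕ 1#) * (m ·ℕ 1# - 1#)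
      m[m-1]≥0 zero    = ≤.reflexive (sym (zeroˡ (0# - 1#)))
      m[m-1]≥0 (suc m) = ≤.≤-respʳ-≈
        (solve 1 (λ m → (con (+ 1) :+ m) :* m := (con (+ 1) :+ m) :* ((con (+ 1) :+ m) :- con (+ 1))) refl (m ·ℕ 1#))
        (*-nonNeg (·ℕ-nonNeg (suc m)) (·ℕ-nonNeg m))
    integer-bound -[1+ m ] {q} {y} q≈-m (0≤y , _) = ≤.≤-respʳ-≈
      (trans (solve 2 (λ m y → let q = :- (con (+ 1) :+ m) in
                (con (+ 1) :+ m) :* m :+ (y :* (con (+ 1) :+ m) :+ y :* (con (+ 1) :+ m)) := (q :* q :+ q) :- (y :+ y) :* q) refl (m ·ℕ 1#) y)
             (+-cong (+-cong (*-cong (sym q≈-m) (sym q≈-m)) (sym q≈-m)) (-‿cong (*-congˡ (sym q≈-m)))))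
      (+-nonNeg (*-nonNeg (·ℕ-nonNeg (suc m)) (·ℕ-nonNeg m)) (+-nonNeg h h))
      where
      h : 0# ≤ y * (suc m ·ℕ 1#)
      h = *-nonNeg 0≤y (·ℕ-nonNeg (suc m))

    -- For q = e i - e j with i ≠ j, comparing squared norms gives 0 ≤ q ∙ q - 2 (x ∙ q) = 2 - 2 (x
    -- i - x j). Conversely, `integer-bound` is summed over the coordinates of an arbitrary q.
    V≐ : V n ≐ λ x → x ∈ H n × (∀ i j → x i - x j ≤ 1#)
    V≐ = to , from
      where
      to : V n ⊆ λ x → x ∈ H n × (∀ i j → x i - x j ≤ 1#)
      to {x} (x∈H , nearest) = x∈H , bound
        where
        bound : ∀ i j → x i - x j ≤ 1#
        bound i j with i ≟ j
        ... | yes ≡.refl = ≤.≤-respˡ-≈ (sym (-‿inverseʳ (x i))) 0≤1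
        ... | no  i≢j with x i - x j ≤.≤? 1#
        ...   | yes p = p
        ...   | no  p = contradiction 0≤2-2d (<⇒≱ (<-by (+-posˡ 0<d-1 (proj₁ 0<d-1))
                  (solve 1 (λ d → con (+ 0) :- ((con (+ 1) :+ con (+ 1)) :- (d :+ d)) := (d :- con (+ 1)) :+ (d :- con (+ 1))) refl (x i - x j))))
          where
          0<d-1 : 0# < (x i - x j) - 1#
          0<d-1 = x<y⇒0<y-x (≰⇒> p)
          q : Point (suc n)
          q l = δ i l - δ j l
          square : sum (λ l → q l * q l - (x l + x l) * q l) ≈ (1# + 1#) - ((x i - x j) + (x i - x j))
          square = begin
            sum (λ l → q l * q l - (x l + x l) * q l)
              ≈⟨ sum-cong-≋ (λ l → solve 3 (λ a b x → (a :- b) :* (a :- b) :- (x :+ x) :* (a :- b)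
                   := a :* ((a :- b) :- (x :+ x)) :- b :* ((a :- b) :- (x :+ x))) refl (δ i l) (δ j l) (x l)) ⟩
            sum (λ l → δ i l * (q l - (x l + x l)) - δ j l * (q l - (x l + x l)))
              ≈⟨ sum-- (λ l → δ i l * (q l - (x l + x l))) (λ l → δ j l * (q l - (x l + x l))) ⟩
            sum (λ l → δ i l * (q l - (x l + x l))) - sum (λ l → δ j l * (q l - (x l + x l)))
              ≈⟨ +-cong (sum-δ i (λ l → q l - (x l + x l))) (-‿cong (sum-δ j (λ l → q l - (x l + x l)))) ⟩
            (δ i i - δ j i - (x i + x i)) - (δ i j - δ j j - (x j + x j))
              ≡⟨ ≡.cong₂ (λ a b → (a - δ j i - (x i + x i)) - (δ i j - b - (x j + x j))) (δ-refl i) (δ-refl j) ⟩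
            (1# - δ j i - (x i + x i)) - (δ i j - 1# - (x j + x j))
              ≡⟨ ≡.cong₂ (λ a b → (1# - a - (x i + x i)) - (b - 1# - (x j + x j))) (δ-≢ (i≢j ∘ ≡.sym)) (δ-≢ i≢j) ⟩
            (1# - 0# - (x i + x i)) - (0# - 1# - (x j + x j))
              ≈⟨ solve 2 (λ x y → (con (+ 1) :- con (+ 0) :- (x :+ x)) :- (con (+ 0) :- con (+ 1) :- (y :+ y))
                   := (con (+ 1) :+ con (+ 1)) :- ((x :- y) :+ (x :- y))) refl (x i) (x j) ⟩
            (1# + 1#) - ((x i - x j) + (x i - x j)) ∎
          0≤2-2d : 0# ≤ (1# + 1#) - ((x i - x j) + (x i - x j))
          0≤2-2d = ≤.≤-respʳ-≈ (trans (+-congʳ (norm²-difference x q))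
              (trans (solve 2 (λ a s → (a :+ s) :- a := s) refl (x ∙ x) (sum (λ l → q l * q l - (x l + x l) * q l))) square))
            (x≤y⇒0≤y-x (√-cancel-≤ (x∙x-nonNeg (x -ᵥ q)) (nearest q (e-difference∈A i j))))
      from : (λ x → x ∈ H n × (∀ i j → x i - x j ≤ 1#)) ⊆ V n
      from {x} (x∈H , bound) with minimum x
      ... | j , min = x∈H , λ q (integral , q∈H) → √-mono (≤-by
            (sum-nonNeg λ l → integer-bound (proj₁ (integral l)) {q l} {x l - x j} (proj₂ (integral l)) (x≤y⇒0≤y-x (min l) , bound l j))
            (begin
              (x -ᵥ q) ∙ (x -ᵥ q) - x ∙ x
                ≈⟨ +-congʳ (norm²-difference x q) ⟩
              x ∙ x + sum (λ l → q l * q l - (x l + x l) * q l) - x ∙ x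
                ≈⟨ solve 2 (λ a s → (a :+ s) :- a := s) refl (x ∙ x) (sum (λ l → q l * q l - (x l + x l) * q l)) ⟩
              sum (λ l → q l * q l - (x l + x l) * q l)
                -- The coordinates of q sum to 0, so a multiple of their sum may be added. The
                -- multiplier 1 + 2 x j supplies the linear term of `integer-bound` and replaces x
                -- by x - x j.
                ≈⟨ solve 2 (λ s c → s := s :+ c :* con (+ 0)) refl (sum (λ l → q l * q l - (x l + x l) * q l)) (1# + (x j + x j)) ⟩
              sum (λ l → q l * q l - (x l + x l) * q l) + (1# + (x j + x j)) * 0#
                ≈⟨ +-congˡ (trans (*-congˡ (sym (H-sum {q} q∈H))) (*-distribˡ-sum (1# + (x j + x j)) q)) ⟩
              sum (λ l → q l * q l - (x l + x l) * q l) + sum (λ l → (1# + (x j + x j)) * q l)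
                ≈⟨ ∑-distrib-+ (λ l → q l * q l - (x l + x l) * q l) (λ l → (1# + (x j + x j)) * q l) ⟨
              sum (λ l → (q l * q l - (x l + x l) * q l) + (1# + (x j + x j)) * q l)
                ≈⟨ sum-cong-≋ (λ l → solve 3 (λ q x y → (q :* q :- (x :+ x) :* q) :+ (con (+ 1) :+ (y :+ y)) :* q
                     := (q :* q :+ q) :- ((x :- y) :+ (x :- y)) :* q) refl (q l) (x l) (x j)) ⟩
              sum (λ l → (q l * q l + q l) - ((x l - x j) + (x l - x j)) * q l) ∎))

-- The dissections and their index sets

module Dissections (ℝ : CompleteOrderedField) where

  open Ordered ℝ
  open Geometry ℝ
  open Euclidean ℝ
  open HyperRhombic ℝ
  open LatticeCells ℝ
  open FinitePermutations
  open import Relation.Binary.Reasoning.Setoid setoid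

  private
    variable
      N n d : ℕ

  relativeInterior-cong : {P Q : PointSet N} → P ≐ Q → relativeInterior P ⊆ relativeInterior Q
  relativeInterior-cong (P⊆Q , Q⊆P) (x∈P , ε , 0<ε , ball) = P⊆Q x∈P , ε , 0<ε ,
    λ { y (k , p , c , p∈Q , rest) near → P⊆Q (ball y (k , p , c , (λ i → Q⊆P (p∈Q i)) , rest) near) }

  IsSimplex-resp-≐ : {P Q : PointSet N} → P ≐ Q → IsSimplex d P → IsSimplex d Q
  IsSimplex-resp-≐ P≐Q (p , independent , P≐) = p , independent , ≐-trans (≐-sym P≐Q) P≐

  δ-inject₁ : (i j : Fin n) → δ (inject₁ i) (inject₁ j) ≡ δ i j
  δ-inject₁ i j with i ≟ j
  ... | yes ≡.refl = δ-refl (inject₁ i)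
  ... | no  i≢j    = δ-≢ (i≢j ∘ Finₚ.inject₁-injective)

  bordered-permutationMatrix : (π : Permutation′ n) → bordered (permutationMatrix π) ≋ₘ permutationMatrix (extend π)
  bordered-permutationMatrix {n} π i j with view i | view j
  ... | ‵inject₁ i′ | ‵inject₁ j′ = reflexive (≡.sym (≡.trans (≡.cong (δ (inject₁ i′)) (extend-inject₁ π j′)) (δ-inject₁ i′ (π ⟨$⟩ʳ j′))))
  ... | ‵fromℕ      | ‵fromℕ      = reflexive (≡.sym (≡.trans (≡.cong (δ (fromℕ n)) (extend-fromℕ π)) (δ-refl (fromℕ n))))
  ... | ‵inject₁ i′ | ‵fromℕ      = reflexive (≡.sym (≡.trans (≡.cong (δ (inject₁ i′)) (extend-fromℕ π))
          (δ-≢ {i = inject₁ i′} {fromℕ n} (Finₚ.fromℕ≢inject₁ ∘ ≡.sym))))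
  ... | ‵fromℕ      | ‵inject₁ j′ = reflexive (≡.sym (≡.trans (≡.cong (δ (fromℕ n)) (extend-inject₁ π j′))
          (δ-≢ {i = fromℕ n} {inject₁ (π ⟨$⟩ʳ j′)} Finₚ.fromℕ≢inject₁)))

  permutationMatrix-injective : (π ρ : Permutation′ n) → permutationMatrix π ≋ₘ permutationMatrix ρ → π Perm.≈ ρ
  permutationMatrix-injective π ρ eq j =
    δ-injective (trans (sym (eq (π ⟨$⟩ʳ j) j)) (reflexive (δ-refl (π ⟨$⟩ʳ j))))

  permutationMatrix-cong : (π ρ : Permutation′ n) → π Perm.≈ ρ → permutationMatrix π ≋ₘ permutationMatrix ρ
  permutationMatrix-cong π ρ π≈ρ i j = reflexive (≡.cong (δ i) (π≈ρ j))

  G₁-permutation : (Q : ∃ (G₁ n)) → proj₁ Q ≋ₘ permutationMatrix (extend (proj₁ (proj₂ Q)))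
  G₁-permutation (Q , π , Q≋π) i j = trans (Q≋π i j) (bordered-permutationMatrix π i j)

  G₁-injective : (Q Q′ : ∃ (G₁ n)) → proj₁ Q ≋ₘ proj₁ Q′ → proj₁ (proj₂ Q) Perm.≈ proj₁ (proj₂ Q′)
  G₁-injective Q@(_ , π , _) Q′@(_ , π′ , _) Q≋Q′ = extend-injective {π = π} {π′}
    (permutationMatrix-injective (extend π) (extend π′) λ i j →
      trans (sym (G₁-permutation Q i j)) (trans (Q≋Q′ i j) (G₁-permutation Q′ i j)))

  G₁-cong : (Q Q′ : ∃ (G₁ n)) → extend (proj₁ (proj₂ Q)) Perm.≈ extend (proj₁ (proj₂ Q′)) → proj₁ Q ≋ₘ proj₁ Q′
  G₁-cong Q@(_ , π , _) Q′@(_ , π′ , _) π≈π′ i j = trans (G₁-permutation Q i j)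
    (trans (permutationMatrix-cong (extend π) (extend π′) π≈π′ i j) (sym (G₁-permutation Q′ i j)))

  bordered-cong : {M M′ : Matrix n} → M ≋ₘ M′ → bordered M ≋ₘ bordered M′
  bordered-cong M≋M′ i j with view i | view j
  ... | ‵inject₁ i′ | ‵inject₁ j′ = M≋M′ i′ j′
  ... | ‵fromℕ      | ‵fromℕ      = refl
  ... | ‵inject₁ i′ | ‵fromℕ      = refl
  ... | ‵fromℕ      | ‵inject₁ j′ = refl

  -- The inverse reads the permutation off the membership witness; this respects equality of
  -- matrices because a matrix determines its permutation pointwise.
  G₁-cardinality : ∀ n → HasCardinality (subsetoid (G₁ n)) (n !)
  G₁-cardinality n = record
    { to        = to
    ; from      = from
    ; to-cong   = λ { ≡.refl → λ _ _ → refl }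
    ; from-cong = λ {Q} {Q′} → from-cong Q Q′
    ; inverse   = (λ { {Q@(_ , π , Q≋π)} ≡.refl i j → trans
                       (bordered-cong (permutationMatrix-cong (enumerate n (index n π)) π (enumerate-index n π)) i j)
                       (sym (Q≋π i j)) })
                , (λ {k} {Q} Q≋ → ≡.trans (from-cong Q (to k) Q≋) (index-enumerate n k))
    }
    where
    to : Fin (n !) → ∃ (G₁ n)
    to k = bordered (permutationMatrix (enumerate n k)) , enumerate n k , λ _ _ → refl
    from : ∃ (G₁ n) → Fin (n !)
    from (_ , π , _) = index n π
    from-cong : ∀ Q Q′ → proj₁ Q ≋ₘ proj₁ Q′ → from Q ≡ from Q′
    from-cong Q Q′ Q≋Q′ = index-cong n {proj₁ (proj₂ Q)} {proj₁ (proj₂ Q′)} (G₁-injective Q Q′ Q≋Q′)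

  -- Column `zero` of `Γ (suc n) s` has its 1 in row s.
  C-shift : (M M′ : ∃ (C (suc n))) → proj₁ M ≋ₘ proj₁ M′ → proj₁ (proj₂ M) ≡ proj₁ (proj₂ M′)
  C-shift {n} (_ , s , M≋s) (_ , s′ , M′≋s′) M≋M′ = ≡.trans (≡.sym (shift-zero n s)) (≡.trans
    (permutationMatrix-injective (shift (suc n) s) (shift (suc n) s′)
      (λ i j → trans (sym (M≋s i j)) (trans (M≋M′ i j) (M′≋s′ i j))) zero)
    (shift-zero n s′))

  C-cardinality : ∀ n → HasCardinality (subsetoid (C (suc n))) (suc n)
  C-cardinality n = record
    { to        = to
    ; from      = λ M → proj₁ (proj₂ M)
    ; to-cong   = λ { ≡.refl → λ _ _ → refl }
    ; from-cong = λ {M} {M′} → C-shift M M′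
    ; inverse   = (λ { {_ , _ , M≋s} ≡.refl i j → sym (M≋s i j) })
                , (λ {s} {M} → C-shift M (to s))
    }
    where
    to : Fin (suc n) → ∃ (C (suc n))
    to s = Γ (suc n) s , s , λ _ _ → refl

  -- Indexed by all permutations of the n + 1 coordinates, so that one family holds the pieces of
  -- every ◇ j: those whose ρ sends the last index to j.
  cell : ∀ n → Permutation′ (suc n) → PointSet (suc n)
  cell n ρ = image (act ρ) (σ₀ n)

  module _ (n : ℕ) where

    cell-isSimplex : ∀ ρ → IsSimplex n (cell n ρ)
    cell-isSimplex ρ = (λ k → act ρ (v n k)) ,
      (λ c sum-c≈0 c≈0 → v-independent n c sum-c≈0 λ l →
        trans (reflexive (≡.cong (combination c (v n)) (≡.sym (Perm.inverseˡ ρ {l})))) (c≈0 (ρ ⟨$⟩ʳ l))) ,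
      (λ { (x , (c , 0≤c , sum-c≈1 , x≋) , y≋) → c , 0≤c , sum-c≈1 , λ l → trans (y≋ l) (x≋ (ρ ⟨$⟩ˡ l)) }) ,
      (λ { (c , 0≤c , sum-c≈1 , y≋) → combination c (v n) , (c , 0≤c , sum-c≈1 , λ _ → refl) , y≋ })

    cell≐ : ∀ ρ → cell n ρ ≐ λ y → y ∈ H n × (∀ {i j} → i Fin.≤ j → InUnitInterval (y (ρ ⟨$⟩ʳ i) - y (ρ ⟨$⟩ʳ j)))
    cell≐ ρ = to , from
      where
      to : cell n ρ ⊆ λ y → y ∈ H n × (∀ {i j} → i Fin.≤ j → InUnitInterval (y (ρ ⟨$⟩ʳ i) - y (ρ ⟨$⟩ʳ j)))
      to {y} (x , x∈σ₀ , y≋) = let (x∈H , bounds) = proj₁ (σ₀≐ n) {x} x∈σ₀ in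
          H-resp-≋ n {act ρ x} {y} (λ i → sym (y≋ i)) (H-act n ρ {x} x∈H) ,
          λ {i} {j} i≤j → [0,1]-resp-≈ (sym (+-cong (y∘ρ i) (-‿cong (y∘ρ j)))) (bounds {i} {j} i≤j)
        where
        y∘ρ : ∀ i → y (ρ ⟨$⟩ʳ i) ≈ x i
        y∘ρ i = trans (y≋ (ρ ⟨$⟩ʳ i)) (reflexive (≡.cong x (Perm.inverseˡ ρ)))
      from : (λ y → y ∈ H n × (∀ {i j} → i Fin.≤ j → InUnitInterval (y (ρ ⟨$⟩ʳ i) - y (ρ ⟨$⟩ʳ j)))) ⊆ cell n ρ
      from {y} (y∈H , bounds) = act (Perm.flip ρ) y ,
        proj₂ (σ₀≐ n) {act (Perm.flip ρ) y} (H-act n (Perm.flip ρ) {y} y∈H , λ {i} {j} → bounds {i} {j}) ,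
        λ i → reflexive (≡.cong y (≡.sym (Perm.inverseʳ ρ)))

    act-◇ : ∀ ρ j → image (act ρ) (◇ n j) ≐ ◇ n (ρ ⟨$⟩ʳ j)
    act-◇ ρ j = to , from
      where
      to : image (act ρ) (◇ n j) ⊆ ◇ n (ρ ⟨$⟩ʳ j)
      to {y} (x , x∈◇ , y≋) = let (x∈H , bounds) = proj₁ (◇≐ n j) {x} x∈◇ in
        proj₂ (◇≐ n (ρ ⟨$⟩ʳ j)) {y}
        (H-resp-≋ n {act ρ x} {y} (λ i → sym (y≋ i)) (H-act n ρ {x} x∈H) ,
         λ i → [0,1]-resp-≈ (sym (+-cong (y≋ i) (-‿cong (trans (y≋ (ρ ⟨$⟩ʳ j)) (reflexive (≡.cong x (Perm.inverseˡ ρ)))))))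
                 (bounds (ρ ⟨$⟩ˡ i)))
      from : ◇ n (ρ ⟨$⟩ʳ j) ⊆ image (act ρ) (◇ n j)
      from {y} y∈◇ = let (y∈H , bounds) = proj₁ (◇≐ n (ρ ⟨$⟩ʳ j)) {y} y∈◇ in
        act (Perm.flip ρ) y ,
        proj₂ (◇≐ n j) {act (Perm.flip ρ) y} (H-act n (Perm.flip ρ) {y} y∈H , λ i → bounds (ρ ⟨$⟩ʳ i)) ,
        λ i → reflexive (≡.cong y (≡.sym (Perm.inverseʳ ρ)))

    cell-interior : ∀ ρ {x} → x ∈ relativeInterior (cell n ρ) →
                    ∀ {i j} → i Fin.< j → x (ρ ⟨$⟩ʳ j) < x (ρ ⟨$⟩ʳ i)
    cell-interior ρ x∈ {i} {j} i<j = relativeInterior-strict (ρ ⟨$⟩ʳ j) (ρ ⟨$⟩ʳ i)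
        (λ {y} y∈ → ≤-by (proj₁ (proj₂ (proj₁ (cell≐ ρ) {y} y∈) (ℕₚ.<⇒≤ i<j))) refl)
        q∈ (<-by 0<1 difference) x∈
      where
      t : Vector R (suc n)
      -- These are the coefficients of the vertex `v n j`, at which coordinate i exceeds coordinate
      -- j by 1.
      t k = χ k j
      q : Point (suc n)
      q = act ρ (combination t (ξ n))
      q∈ : q ∈ cell n ρ
      q∈ = combination t (ξ n) , proj₂ (σ₀≐ n) {combination t (ξ n)} (combination-ξ∈H n t , λ {a} {b} a≤b →
             [0,1]-resp-≈ (sym (combination-ξ-difference n t a b)) (χ-difference {i = a} {b} a≤b j)) , λ _ → refl
      difference : q (ρ ⟨$⟩ʳ i) - q (ρ ⟨$⟩ʳ j) ≈ 1#
      difference = begin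
        q (ρ ⟨$⟩ʳ i) - q (ρ ⟨$⟩ʳ j)
          ≡⟨ ≡.cong₂ (λ a b → combination t (ξ n) a - combination t (ξ n) b) (Perm.inverseˡ ρ) (Perm.inverseˡ ρ) ⟩
        combination t (ξ n) i - combination t (ξ n) j
          ≈⟨ combination-ξ-difference n t i j ⟩
        χ i j - χ j j
          ≡⟨ ≡.cong₂ _-_ (χ-< {i = i} {j} i<j) (χ-≥ {i = j} {j} ℕₚ.≤-refl) ⟩
        1# - 0#
          ≈⟨ solve 0 (con (+ 1) :- con (+ 0) := con (+ 1)) refl ⟩
        1# ∎

    cell-interiors-meet : ∀ π ρ {x} → x ∈ relativeInterior (cell n π) → x ∈ relativeInterior (cell n ρ) → π Perm.≈ ρ
    cell-interiors-meet π ρ {x} x∈π x∈ρ = increasing-unique {_≺_ = λ i j → x j < x i}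
      (λ xj<xi xi<xj → <⇒≱ xj<xi (proj₁ xi<xj)) π ρ (cell-interior π {x} x∈π) (cell-interior ρ {x} x∈ρ)

    ◇-interior : ∀ {i j x} → x ∈ relativeInterior (◇ n j) → i ≢ j → x j < x i
    ◇-interior {i} {j} x∈ i≢j = relativeInterior-strict j i
        (λ {y} y∈ → ≤-by (proj₁ (proj₂ (proj₁ (◇≐ n j) {y} y∈) i)) refl) q∈ (<-by 0<1 (trans (difference i) (reflexive (δ-refl i)))) x∈
      where
      q : Point (suc n)
      -- The vertex ξ i, written as a combination so that `combination-ξ-difference` applies.
      q = combination (δ i) (ξ n)
      difference : ∀ k → q k - q j ≈ δ i k
      difference k = begin
        q k - q j        ≈⟨ combination-ξ-difference n (δ i) k j ⟩
        δ i k - δ i j    ≡⟨ ≡.cong (λ a → δ i k - a) (δ-≢ i≢j) ⟩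
        δ i k - 0#       ≈⟨ solve 1 (λ x → x :- con (+ 0) := x) refl (δ i k) ⟩
        δ i k            ∎
      q∈ : q ∈ ◇ n j
      q∈ = proj₂ (◇≐ n j) {q} (combination-ξ∈H n (δ i) , λ k → [0,1]-resp-≈ (sym (difference k)) (δ∈[0,1] i k))

    ◇-interiors-meet : ∀ {i j x} → x ∈ relativeInterior (◇ n i) → x ∈ relativeInterior (◇ n j) → i ≡ j
    ◇-interiors-meet {i} {j} {x} x∈i x∈j with i ≟ j
    ... | yes i≡j = i≡j
    ... | no  i≢j = contradiction (proj₁ (◇-interior {x = x} x∈i (i≢j ∘ ≡.sym))) (<⇒≱ (◇-interior {x = x} x∈j i≢j))

    V⊆⋃◇ : V n ⊆ ⋃ (Fin (suc n)) (◇ n)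
    V⊆⋃◇ {x} x∈V = let (x∈H , bound) = proj₁ (V≐ n) {x} x∈V; (j , min) = minimum x in
      j , proj₂ (◇≐ n j) {x} (x∈H , λ i → x≤y⇒0≤y-x (min i) , bound i j)

    ◇⊆V : ∀ j → ◇ n j ⊆ V n
    ◇⊆V j {x} x∈◇ = let (x∈H , bounds) = proj₁ (◇≐ n j) {x} x∈◇ in proj₂ (V≐ n) {x} (x∈H , λ i k →
      ≤-by (+-nonNeg (x≤y⇒0≤y-x (proj₂ (bounds i))) (proj₁ (bounds k)))
        (solve 3 (λ xi xj xk → con (+ 1) :- (xi :- xk) := (con (+ 1) :- (xi :- xj)) :+ (xk :- xj)) refl (x i) (x j) (x k)))

    V-dissection : IsDisjointUnion (V n) (FinS (suc n)) (◇ n)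
    V-dissection = (V⊆⋃◇ , λ (j , x∈◇) → ◇⊆V j x∈◇) ,
      λ i j i≢j {x} (x∈i , x∈j) → i≢j (◇-interiors-meet {i} {j} {x} x∈i x∈j)

    -- In the sorted order the last coordinate is least, and `extend π` keeps the last index for τ
    -- to place. Taking `Perm.id` for τ serves the dissection indexed by `G₁`; `rotation j` serves
    -- the other hyper-rhombi.
    cell⊆◇ : ∀ (τ : Permutation′ (suc n)) π → cell n (extend π ∘ₚ τ) ⊆ ◇ n (τ ⟨$⟩ʳ fromℕ n)
    cell⊆◇ τ π {x} x∈cell = let (x∈H , bounds) = proj₁ (cell≐ (extend π ∘ₚ τ)) {x} x∈cell in
      proj₂ (◇≐ n (τ ⟨$⟩ʳ fromℕ n)) {x} (x∈H , λ i → ≡.subst₂ (λ a b → InUnitInterval (x a - x b))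
            (Perm.inverseʳ (extend π ∘ₚ τ)) (≡.cong (τ ⟨$⟩ʳ_) (extend-fromℕ π))
            (bounds {(extend π ∘ₚ τ) ⟨$⟩ˡ i} {fromℕ n} (Finₚ.≤fromℕ ((extend π ∘ₚ τ) ⟨$⟩ˡ i))))

    -- The least coordinate is already in last place, so only the other n coordinates are sorted.
    ◇⊆⋃cell : ∀ (τ : Permutation′ (suc n)) {x} → x ∈ ◇ n (τ ⟨$⟩ʳ fromℕ n) → ∃ λ π → x ∈ cell n (extend π ∘ₚ τ)
    ◇⊆⋃cell τ {x} x∈◇ = π , proj₂ (cell≐ (extend π ∘ₚ τ)) {x} (x∈H , λ {i} {j} → ordered i j)
      where
      x∈H : x ∈ H n
      x∈H = proj₁ (proj₁ (◇≐ n (τ ⟨$⟩ʳ fromℕ n)) {x} x∈◇)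
      bounds : ∀ i → InUnitInterval (x i - x (τ ⟨$⟩ʳ fromℕ n))
      bounds = proj₂ (proj₁ (◇≐ n (τ ⟨$⟩ʳ fromℕ n)) {x} x∈◇)
      π : Permutation′ n
      π = proj₁ (sort (λ i → x (τ ⟨$⟩ʳ inject₁ i)))
      sorted : ∀ {i j} → i Fin.≤ j → x (τ ⟨$⟩ʳ inject₁ (π ⟨$⟩ʳ j)) ≤ x (τ ⟨$⟩ʳ inject₁ (π ⟨$⟩ʳ i))
      sorted = proj₂ (sort (λ i → x (τ ⟨$⟩ʳ inject₁ i)))
      y : Fin (suc n) → R
      y i = x (τ ⟨$⟩ʳ (extend π ⟨$⟩ʳ i))
      y-fromℕ : y (fromℕ n) ≡ x (τ ⟨$⟩ʳ fromℕ n)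
      y-fromℕ = ≡.cong (λ i → x (τ ⟨$⟩ʳ i)) (extend-fromℕ π)
      y-inject₁ : ∀ i → y (inject₁ i) ≡ x (τ ⟨$⟩ʳ inject₁ (π ⟨$⟩ʳ i))
      y-inject₁ i = ≡.cong (λ i → x (τ ⟨$⟩ʳ i)) (extend-inject₁ π i)
      bounds-y : ∀ i → InUnitInterval (y i - y (fromℕ n))
      bounds-y i = ≡.subst (λ a → InUnitInterval (y i - a)) (≡.sym y-fromℕ) (bounds (τ ⟨$⟩ʳ (extend π ⟨$⟩ʳ i)))
      descending : ∀ i j → i Fin.≤ j → y j ≤ y i
      descending i j i≤j with view i | view j
      ... | _           | ‵fromℕ      = ≤-by (proj₁ (bounds-y i)) refl
      ... | ‵fromℕ      | ‵inject₁ j′ = contradiction i≤j (ℕₚ.<⇒≱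
              (≡.subst₂ ℕ._<_ (≡.sym (Finₚ.toℕ-inject₁ j′)) (≡.sym (Finₚ.toℕ-fromℕ n)) (Finₚ.toℕ<n j′)))
      ... | ‵inject₁ i′ | ‵inject₁ j′ = ≡.subst₂ _≤_ (≡.sym (y-inject₁ j′)) (≡.sym (y-inject₁ i′))
              (sorted (≡.subst₂ ℕ._≤_ (Finₚ.toℕ-inject₁ i′) (Finₚ.toℕ-inject₁ j′) i≤j))
      ordered : ∀ i j → i Fin.≤ j → InUnitInterval (y i - y j)
      ordered i j i≤j = x≤y⇒0≤y-x (descending i j i≤j) ,
        ≤-by (+-nonNeg (x≤y⇒0≤y-x (proj₂ (bounds-y i))) (proj₁ (bounds-y j)))
          (solve 3 (λ xi xj xk → con (+ 1) :- (xi :- xk) := (con (+ 1) :- (xi :- xj)) :+ (xk :- xj)) refl (y i) (y (fromℕ n)) (y j))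

    -- The shift that takes the last hyper-rhombus to ◇ j; `suc (toℕ j)` is the number of j counted
    -- from 1.
    rotation : Fin (suc n) → Permutation′ (suc n)
    rotation j = shift (suc n) (suc (toℕ j) mod suc n)

    ◇≐rotation : ∀ j → image (act (rotation j)) (◇ n (fromℕ n)) ≐ ◇ n j
    ◇≐rotation j = ≡.subst (λ i → image (act (rotation j)) (◇ n (fromℕ n)) ≐ ◇ n i) (shift-fromℕ n j) (act-◇ (rotation j) (fromℕ n))

    ◇-congruent : ∀ j k → ◇ n j ≅ ◇ n k
    ◇-congruent j k = ≅-resp-≐ (◇≐rotation j) (◇≐rotation k)
      (act-images-congruent (rotation j) (rotation k) (◇ n (fromℕ n)))

    ◇-composed : ∀ j → ComposedOfCongruent (n !) (IsSimplex n) (◇ n j)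
    ◇-composed j = piece , (cover , disjoint) , (λ k → cell-isSimplex (ρ k)) ,
        λ k l → act-images-congruent (ρ k) (ρ l) (σ₀ n)
      where
      τ = rotation j
      ρ : Fin (n !) → Permutation′ (suc n)
      ρ k = extend (enumerate n k) ∘ₚ τ
      piece : Fin (n !) → PointSet (suc n)
      piece k = cell n (ρ k)
      -- The enumeration returns π only up to pointwise equality, so membership is transported
      -- through the coordinate description of the cells.
      cell-index : ∀ π {x} → x ∈ cell n (extend π ∘ₚ τ) → x ∈ piece (index n π)
      cell-index π {x} x∈ = let (x∈H , bounds) = proj₁ (cell≐ (extend π ∘ₚ τ)) {x} x∈ in
          proj₂ (cell≐ (ρ (index n π))) {x} (x∈H , λ {i} {j} i≤j →
            ≡.subst₂ (λ a b → InUnitInterval (x (τ ⟨$⟩ʳ a) - x (τ ⟨$⟩ʳ b))) (same i) (same j) (bounds {i} {j} i≤j))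
        where
        same : ∀ i → extend π ⟨$⟩ʳ i ≡ extend (enumerate n (index n π)) ⟨$⟩ʳ i
        same i = ≡.sym (insert-cong (fromℕ n) (fromℕ n) {enumerate n (index n π)} {π} (enumerate-index n π) i)
      cover : ◇ n j ≐ ⋃ (Fin (n !)) piece
      cover = (λ {x} x∈◇ → let (π , x∈) = ◇⊆⋃cell τ {x} (≡.subst (λ i → ◇ n i x) (≡.sym (shift-fromℕ n j)) x∈◇) in
                index n π , cell-index π {x} x∈) ,
              (λ {x} (k , x∈) → ≡.subst (λ i → ◇ n i x) (shift-fromℕ n j) (cell⊆◇ τ (enumerate n k) {x} x∈))
      disjoint : ∀ k l → k ≢ l → ∀ {x} → ¬ (x ∈ relativeInterior (piece k) × x ∈ relativeInterior (piece l))
      disjoint k l k≢l {x} (x∈k , x∈l) = k≢l (≡.trans (≡.sym (index-enumerate n k)) (≡.trans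
        (index-cong n {enumerate n k} {enumerate n l} (extend-injective {π = enumerate n k} {enumerate n l}
          λ i → permutation-injective τ (cell-interiors-meet (ρ k) (ρ l) {x} x∈k x∈l i)))
        (index-enumerate n l)))

    G₁-cell : (Q : ∃ (G₁ n)) → proj₁ Q *ₛ σ₀ n ≐ cell n (extend (proj₁ (proj₂ Q)))
    G₁-cell Q@(_ , π , _) = *ₛ≐act (extend π) (G₁-permutation Q) (σ₀ n)

    ◇-dissection : IsDisjointUnion (◇ n (fromℕ n)) (subsetoid (G₁ n)) (λ Q → proj₁ Q *ₛ σ₀ n)
    ◇-dissection =
      ( (λ {x} x∈◇ → let (π , x∈) = ◇⊆⋃cell Perm.id {x} x∈◇
                         Q = bordered (permutationMatrix π) , π , λ _ _ → refl in
            Q , proj₂ (G₁-cell Q) {x} x∈)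
      , (λ {x} (Q , x∈) → cell⊆◇ Perm.id (proj₁ (proj₂ Q)) {x} (proj₁ (G₁-cell Q) {x} x∈)) ) ,
      λ Q Q′ Q≉Q′ {x} (x∈ , x∈′) → Q≉Q′ (G₁-cong Q Q′
        (cell-interiors-meet (extend (proj₁ (proj₂ Q))) (extend (proj₁ (proj₂ Q′))) {x}
          (relativeInterior-cong (G₁-cell Q) {x} x∈) (relativeInterior-cong (G₁-cell Q′) {x} x∈′)))

    C-◇ : (M : ∃ (C (suc n))) → proj₁ M *ₛ ◇ n (fromℕ n) ≐ ◇ n (shift (suc n) (proj₁ (proj₂ M)) ⟨$⟩ʳ fromℕ n)
    C-◇ (_ , s , M≋s) = ≐-trans (*ₛ≐act (shift (suc n) s) M≋s (◇ n (fromℕ n))) (act-◇ (shift (suc n) s) (fromℕ n))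

    V-rotations : IsDisjointUnion (V n) (subsetoid (C (suc n))) (λ M → proj₁ M *ₛ ◇ n (fromℕ n))
    V-rotations =
      ( (λ {x} x∈V → let (j , x∈◇) = V⊆⋃◇ {x} x∈V
                         M = Γ (suc n) (suc (toℕ j) mod suc n) , (suc (toℕ j) mod suc n) , λ _ _ → refl in
            M , proj₂ (C-◇ M) {x} (≡.subst (λ i → ◇ n i x) (≡.sym (shift-fromℕ n j)) x∈◇))
      , (λ {x} (M , x∈) → ◇⊆V (shift (suc n) (proj₁ (proj₂ M)) ⟨$⟩ʳ fromℕ n) {x} (proj₁ (C-◇ M) {x} x∈)) ) ,
      λ { M@(_ , s , M≋s) M′@(_ , s′ , M′≋s′) M≉M′ {x} (x∈ , x∈′) → M≉M′ λ i j → trans (M≋s i j) (trans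
          (reflexive (≡.cong (λ s → Γ (suc n) s i j) (shift-fromℕ-injective n s s′
            (◇-interiors-meet {x = x} (relativeInterior-cong (C-◇ M) {x} x∈) (relativeInterior-cong (C-◇ M′) {x} x∈′)))))
          (sym (M′≋s′ i j))) }

  ◇-isHyperRhombus : ∀ n → n ≥ 2 → ∀ j → IsHyperRhombus n (◇ n j)
  ◇-isHyperRhombus n@(suc (suc m)) (s≤s (s≤s z≤n)) j = isHyperRhombus m 0ᵥ (removeAt (ξ n) j)
    (removeAt-ξ-independent n j) (removeAt-gram (ξ n) j (ξ-gram n)) ((λ x∈ → x∈) , (λ x∈ → x∈))

lemma5 : (ℝ : CompleteOrderedField) → let open Geometry ℝ in
  (n : ℕ) → n ≥ 2 →
  -- V(0) consists of n+1 congruent hyper-rhombi, each of n! congruent simplices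
  ComposedOfCongruent (suc n) (λ D → IsHyperRhombus n D × ComposedOfCongruent (n !) (IsSimplex n) D) (V n)
  -- the n! congruent simplices Q σ₀, Q ∈ G₁, form the hyper-rhombus ◇ₙ₊₁; every ◇ⱼ is a hyper-rhombus
  × HasCardinality (subsetoid (G₁ n)) (n !)
  × (∀ Q → G₁ n Q → IsSimplex n (Q *ₛ σ₀ n))
  × (∀ Q Q′ → G₁ n Q → G₁ n Q′ → Q *ₛ σ₀ n ≅ Q′ *ₛ σ₀ n)
  × (∀ j → IsHyperRhombus n (◇ n j))
  × IsDisjointUnion (◇ n (fromℕ n)) (subsetoid (G₁ n)) (λ Q → proj₁ Q *ₛ σ₀ n)
  -- the n+1 circular shifts of ◇ₙ₊₁ form V(0)
  × HasCardinality (subsetoid (C (suc n))) (suc n)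
  × IsDisjointUnion (V n) (subsetoid (C (suc n))) (λ M → proj₁ M *ₛ ◇ n (fromℕ n))
  × IsDisjointUnion (V n) (FinS (suc n)) (◇ n)
  × (∀ j k → ◇ n j ≅ ◇ n k)
  × (∀ j → ◇ n j ≐ Γ (suc n) (suc (toℕ j) mod suc n) *ₛ ◇ n (fromℕ n))
lemma5 ℝ n n≥2 =
    (◇ n , V-dissection n , (λ j → ◇-isHyperRhombus n n≥2 j , ◇-composed n j) , ◇-congruent n)
  , G₁-cardinality n
  , (λ Q Q∈ → IsSimplex-resp-≐ (≐-sym (G₁-cell n (Q , Q∈))) (cell-isSimplex n (extend (proj₁ Q∈))))
  , (λ Q Q′ Q∈ Q′∈ → ≅-resp-≐ (≐-sym (G₁-cell n (Q , Q∈))) (≐-sym (G₁-cell n (Q′ , Q′∈)))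
       (act-images-congruent (extend (proj₁ Q∈)) (extend (proj₁ Q′∈)) (σ₀ n)))
  , ◇-isHyperRhombus n n≥2
  , ◇-dissection n
  , C-cardinality n
  , V-rotations n
  , V-dissection n
  , ◇-congruent n
  , (λ j → ≐-trans (≐-sym (◇≐rotation n j)) (≐-sym (*ₛ≐act (rotation n j) (λ _ _ → CompleteOrderedField.refl ℝ) (◇ n (fromℕ n)))))
  where
  open Geometry ℝ
  open Euclidean ℝ using (≅-resp-≐; act-images-congruent; *ₛ≐act)
  open Dissections ℝ
  open FinitePermutations using (extend)
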